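{- Let $n\ge2$, $(\pi,v)\in\operatorname{Vert}(B_n)$ and $a,b\in v([n])$. Then $(\pi,v)$ has a rise labelled $(a,b)$ if and only if $\zeta_B(\pi,v)=(\zeta_B(\pi),d_B(\pi,v))$ has a valley labelled $(b,a)$ or $(-a,-b)$. Furthermore, $\pi$ begins with a North step if and only if $\zeta_B(\pi,v)$ has a valley labelled $(v(1),0)$.
   Context: $\mathcal L_{n,n}$: words in $\{N,E\}$ with $n$ of each letter; $\mathcal B_{2n}$: words of length $2n$ whose prefixes have at least as many $N$'s as $E$'s. Rise $i$: the $i$-th North step is immediately followed by a North step. Valley $(i,j)$: the $i$-th East step is immediately followed by the $j$-th North step; also $(i,j+1)$ if a ballot path with $i$ East and $j$ North steps ends with an East step. $\mathfrak S_n^B$: bijections $w$ of $\{\pm1,\dots,\pm n\}$ with $w(-i)=-w(i)$; we set $w(0)=0$. $\operatorname{Vert}(B_n)$: pairs $(\pi,v)$ with $\pi\in\mathcal L_{n,n}$, $v\in\mathfrak S_n^B$, $v(i)<v(i+1)$ for every rise $i$ of $\pi$, and $v(1)>0$ if $\pi$ begins with a North step. For $\pi$: $\pi_i$ = number of East steps before the $i$-th North step; $\lambda_i=\pi_i$ ($i<n$), $\lambda_n=2\pi_n-\pi_{n-1}$ if $\pi_1+\dots+\pi_{n-2}$ even, $2n+1-2\pi_n+\pi_{n-1}$ if odd; area vector $\mu_i=\lambda_i-i$ ($i<n$), $\mu_n=\lambda_n-n$ if $n\equiv0,3\pmod4$, $\mu_n=n+1-\lambda_n$ if $n\equiv1,2\pmod4$.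 For $a\in\mathbb Z^n$, $j\ge0$: $\overrightarrow{S}^+_j(a)$ reads $a$ left to right writing $N$ for entries $j$, $E$ for entries $j+1$; $\overleftarrow{S}^+_j(a)$ reads right to left; $\overrightarrow{S}^-_j,\overleftarrow{S}^-_j$ likewise with $N$ for $-j$, $E$ for $-j-1$. $\zeta_B(\pi)=\overleftarrow{S}^-_{2n}(\mu)\overrightarrow{S}^+_{2n}(\mu)\cdots\overleftarrow{S}^-_1(\mu)\overrightarrow{S}^+_1(\mu)\overleftarrow{S}^-_0(\mu)(N\overrightarrow{S}^+_0(\mu))^\circ$, $(\cdot)^\circ$ deleting the last letter. $d_B(\pi,v)$: for $i=0,1,2,\dots$ write $v(j)$ for rows $j$ with $\mu_j=-i$ in increasing $j$, then $-v(j)$ for rows $j$ with $\mu_j=i+1$ in decreasing $j$; finally, if $\mu_{n-1}+\mu_n$ is even, change the sign of the entry coming from row $n$; the result is the window of $d_B(\pi,v)\in\mathfrak S_n^B$. Labels: a rise $i$ of $(\pi,v)$ is labelled $(v(i),v(i+1))$; for $\beta\in\mathcal B_{2n}$ and $w\in\mathfrak S_n^B$, a valley $(i,j)$ of $\beta$ is labelled $(w(n+1-i),w(n+1-j))$ (using $w(0)=0$, $w(-k)=-w(k)$). -}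

module Defs where

open import Data.Bool using (Bool; true; false; if_then_else_; _∨_)
open import Data.Nat as ℕ using (ℕ; zero; suc; _≡ᵇ_; _∸_)
open import Data.Nat.DivMod using (_%_)
open import Data.Integer as ℤ using (ℤ; +_; -[1+_]; ∣_∣)
open import Data.List using (List; []; _∷_; _++_; map; reverse; concat; concatMap; filter; upTo; length; take; zip)
open import Data.Nat.ListAction using (sum)
open import Data.List.Membership.Propositional using (_∈_)
open import Data.List.Relation.Unary.All using (All)
open import Data.List.Relation.Unary.Unique.Propositional using (Unique)
open import Data.Product using (_×_; _,_; ∃; proj₁; proj₂)
open import Relation.Binary.PropositionalEquality using (_≡_; _≢_)
open import Relation.Nullary using (does)

data Step : Set where
  N E : Step

countN countE : List Step → ℕ
countN [] = 0
countN (N ∷ r) = suc (countN r)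
countN (E ∷ r) = countN r
countE [] = 0
countE (N ∷ r) = countE r
countE (E ∷ r) = suc (countE r)

InL : ℕ → List Step → Set
InL n π = (countN π ≡ n) × (countE π ≡ n)

data StartsWithN : List Step → Set where
  startsN : ∀ r → StartsWithN (N ∷ r)

risesFrom : ℕ → List Step → List ℕ
risesFrom k [] = []
risesFrom k (N ∷ N ∷ r) = suc k ∷ risesFrom (suc k) (N ∷ r)
risesFrom k (N ∷ r) = risesFrom (suc k) r
risesFrom k (E ∷ r) = risesFrom k r

rises : List Step → List ℕ
rises = risesFrom 0

valleysFrom : ℕ → ℕ → List Step → List (ℕ × ℕ)
valleysFrom i j [] = []
valleysFrom i j (E ∷ []) = (suc i , suc j) ∷ []
valleysFrom i j (E ∷ N ∷ r) = (suc i , suc j) ∷ valleysFrom (suc i) j (N ∷ r)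
valleysFrom i j (E ∷ E ∷ r) = valleysFrom (suc i) j (E ∷ r)
valleysFrom i j (N ∷ r) = valleysFrom i (suc j) r

valleys : List Step → List (ℕ × ℕ)
valleys = valleysFrom 0 0

-- Signed permutations, given by their window (w(1), ..., w(n))

nth : List ℤ → ℕ → ℤ
nth [] k = + 0
nth (x ∷ xs) zero = x
nth (x ∷ xs) (suc k) = nth xs k

evalB : List ℤ → ℤ → ℤ
evalB w (+ zero) = + 0
evalB w (+ suc m) = nth w m
evalB w -[1+ m ] = ℤ.- nth w m

at : List ℤ → ℕ → ℤ
at v i = evalB v (+ i)

SignedPerm : ℕ → List ℤ → Set
SignedPerm n v =
  (length v ≡ n) × All (λ x → (x ≢ + 0) × (∣ x ∣ ℕ.≤ n)) v × Unique (map ∣_∣ v)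

InVert : ℕ → List Step → List ℤ → Set
InVert n π v =
  InL n π × SignedPerm n v
  × (∀ i → i ∈ rises π → at v i ℤ.< at v (suc i))
  × (StartsWithN π → + 0 ℤ.< at v 1)

isEven : ℕ → Bool
isEven zero = true
isEven (suc zero) = false
isEven (suc (suc k)) = isEven k

piSeqFrom : ℕ → List Step → List ℕ
piSeqFrom e [] = []
piSeqFrom e (N ∷ r) = e ∷ piSeqFrom e r
piSeqFrom e (E ∷ r) = piSeqFrom (suc e) r

piSeq : List Step → List ℕ
piSeq = piSeqFrom 0

piAt : List Step → ℕ → ℤ
piAt π i = at (map +_ (piSeq π)) i

lambdaLast : ℕ → List Step → ℤ
lambdaLast n π =
  if isEven (sum (take (n ∸ 2) (piSeq π)))
  then (+ 2 ℤ.* piAt π n) ℤ.- piAt π (n ∸ 1)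
  else ((+ (2 ℕ.* n ℕ.+ 1)) ℤ.- (+ 2 ℤ.* piAt π n)) ℤ.+ piAt π (n ∸ 1)

muAt : ℕ → List Step → ℕ → ℤ
muAt n π i =
  if i ≡ᵇ n
  then (if ((n % 4) ≡ᵇ 0) ∨ ((n % 4) ≡ᵇ 3)
        then lambdaLast n π ℤ.- + n
        else + (suc n) ℤ.- lambdaLast n π)
  else piAt π i ℤ.- + i

mu : ℕ → List Step → List ℤ
mu n π = map (λ k → muAt n π (suc k)) (upTo n)

_==_ : ℤ → ℤ → Bool
x == y = does (x ℤ.≟ y)

scan : ℤ → ℤ → List ℤ → List Step
scan x y = concatMap (λ a → if a == x then N ∷ [] else (if a == y then E ∷ [] else []))

S⁺→ S⁺← S⁻→ S⁻← : ℕ → List ℤ → List Step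
S⁺→ j a = scan (+ j) (+ suc j) a
S⁺← j a = scan (+ j) (+ suc j) (reverse a)
S⁻→ j a = scan (ℤ.- + j) (ℤ.- + suc j) a
S⁻← j a = scan (ℤ.- + j) (ℤ.- + suc j) (reverse a)

dropLast : List Step → List Step
dropLast [] = []
dropLast (x ∷ []) = []
dropLast (x ∷ y ∷ r) = x ∷ dropLast (y ∷ r)

zetaHigh : ℕ → List ℤ → List Step
zetaHigh zero a = []
zetaHigh (suc j) a = S⁻← (suc j) a ++ S⁺→ (suc j) a ++ zetaHigh j a

zetaB : ℕ → List Step → List Step
zetaB n π = zetaHigh (2 ℕ.* n) μ ++ S⁻← 0 μ ++ dropLast (N ∷ S⁺→ 0 μ)
  where μ = mu n π

rowsMu : ℕ → List Step → List (ℕ × ℤ)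
rowsMu n π = map (λ k → (suc k , muAt n π (suc k))) (upTo n)

dStep : ℕ → List Step → List ℤ → ℕ → List (ℕ × ℤ)
dStep n π v i =
  map (λ r → (proj₁ r , at v (proj₁ r)))
      (filter (λ r → proj₂ r ℤ.≟ ℤ.- + i) (rowsMu n π))
  ++ map (λ r → (proj₁ r , ℤ.- at v (proj₁ r)))
      (reverse (filter (λ r → proj₂ r ℤ.≟ + suc i) (rowsMu n π)))

-- i ranges over 0 .. Σ|μ_j|, which covers every row (row j occurs at
-- i = -μ_j if μ_j ≤ 0 and at i = μ_j - 1 if μ_j ≥ 1); further steps are empty
dBound : ℕ → List Step → ℕ
dBound n π = sum (map ∣_∣ (mu n π))

dTagged : ℕ → List Step → List ℤ → List (ℕ × ℤ)
dTagged n π v = concatMap (dStep n π v) (upTo (suc (dBound n π)))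

dB : ℕ → List Step → List ℤ → List ℤ
dB n π v =
  map (λ r → if (proj₁ r ≡ᵇ n) ∧' flip then ℤ.- proj₂ r else proj₂ r)
      (dTagged n π v)
  where
    flip : Bool
    flip = isEven ∣ muAt n π (n ∸ 1) ℤ.+ muAt n π n ∣
    _∧'_ : Bool → Bool → Bool
    true ∧' b = b
    false ∧' b = false

HasRiseLabel : List Step → List ℤ → ℤ → ℤ → Set
HasRiseLabel π v a b =
  ∃ λ i → (i ∈ rises π) × (at v i ≡ a) × (at v (suc i) ≡ b)

HasValleyLabel : ℕ → List Step → List ℤ → ℤ → ℤ → Set
HasValleyLabel n β w a b =
  ∃ λ ij → (ij ∈ valleys β)
    × (evalB w (+ suc n ℤ.- + proj₁ ij) ≡ a)
    × (evalB w (+ suc n ℤ.- + proj₂ ij) ≡ b)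

module Submission where

open import Defs
open import Data.Nat using (ℕ; _≤_)
open import Data.Integer using (ℤ; +_; -_)
open import Data.List using (List)
open import Data.List.Membership.Propositional using (_∈_)
open import Data.Product using (_×_)
open import Data.Sum using (_⊎_)
open import Function.Bundles using (_⇔_)
open import Data.Nat as ℕ using (zero; suc; s≤s; z≤n; _<_; _≡ᵇ_)
open import Data.Integer as ℤ using (-[1+_]; ∣_∣)
open import Data.Integer.Tactic.RingSolver using (solve-∀)
open import Data.Bool using (if_then_else_; Bool; true; false; _∧_; _∨_)
open import Data.List using ([]; _∷_; _++_; map; concatMap; reverse; length; _ʳ++_; applyUpTo; applyDownFrom; filter; upTo; take)
open import Data.List.Properties using (++-assoc; concatMap-++; ++-identityʳ; reverse-++; map-++; length-++; length-reverse; length-map; ʳ++-defn; reverse-involutive; map-applyUpTo; reverse-applyUpTo; applyDownFrom-∷ʳ; map-∘; map-cong; map-concatMap; reverse-map; concatMap-cong; upTo-∷ʳ; map-upTo; applyUpTo-∷ʳ; length-applyUpTo)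
open import Data.List.Relation.Unary.Any using (here; there)
open import Data.List.Relation.Unary.All as All using (All; []; _∷_)
open import Data.List.Relation.Unary.Linked as Linked using (Linked; []; _∷_)
open import Data.Product using (_,_; ∃₂; proj₁; proj₂; ∃-syntax)
open import Data.Sum as Sum using (inj₁; inj₂)
open import Data.Unit using (⊤; tt)
open import Data.Empty using (⊥; ⊥-elim)
open import Relation.Nullary using (yes; no; ¬_)
open import Function using (_∘_)
open import Relation.Binary.Definitions using (tri<; tri≈; tri>)
open import Data.Nat.DivMod using (_%_)
open import Data.Nat.ListAction using (sum)
open import Data.List.Relation.Unary.AllPairs using ([]; _∷_)
open import Data.List.Relation.Unary.Unique.Propositional using (Unique)
open import Data.List.Membership.Propositional.Properties using (∈-map⁺)
open import Function.Bundles using (mk⇔; Equivalence)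
import Data.Nat.Properties as ℕP
import Data.Integer.Properties as ℤP
import Data.List.Relation.Unary.All.Properties as AllP
open import Relation.Binary.PropositionalEquality
import Data.Nat.Tactic.RingSolver as ℕSolver
import Data.List.Relation.Unary.Linked.Properties as LinkedP

-- Let x = 2π_n − π_{n−1} − n. Then μ_n is x or 1 − x, and the sign change in d_B happens exactly in
-- the second case. Replacing x by 1 − x reverses the sign with which row n is written, but not the
-- places of its letters and of its window entry, apart from the deleted last letter of ζ_B. Hence
-- ζ_B and d_B may be computed from c = (μ_1, ..., μ_{n−1}, x) without the sign change. This sequence
-- descends by at most one at every step, and by exactly one at the rises; c_1 ≥ −1, with equality iff
-- π begins with N; and c_n ≤ 1 − c_{n−1}.
-- Keep for every letter of ζ_B the signed label of the row that writes it. The successive labels of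
-- the N's, and those of the E's, are w(n), w(n−1), ..., so valley labels are read off the labelled
-- word. A drop c_{i+1} = c_i − 1 puts E and N next to each other in one scan, leftwards (labels v(i+1),
-- v(i)) if c_i ≤ 0 and rightwards (labels −v(i), −v(i+1)) otherwise. Conversely, since the heights
-- descend by at most one, an E followed by N comes from a drop or precedes the central N of label 0;
-- deleting the last letter adds at most one valley, whose labels have opposite signs.

-- Integer inequalities and equations compared through differences.

≤-by : ∀ {a b c d} → a ℤ.≤ b → d ℤ.- c ≡ b ℤ.- a → c ℤ.≤ d
≤-by a≤b eq = ℤP.0≤i-j⇒j≤i (subst (+ 0 ℤ.≤_) (sym eq) (ℤP.i≤j⇒0≤j-i a≤b))

≡-by : ∀ {a b c d} → a ≡ b → d ℤ.- c ≡ b ℤ.- a → c ≡ d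
≡-by {a} {b} {c} {d} refl eq = sym (ℤP.i-j≡0⇒i≡j d c (trans eq (ℤP.+-inverseʳ a)))

1+n≰n : ∀ {j} → ¬ (+ suc j ℤ.≤ + j)
1+n≰n = ℕP.1+n≰n ∘ ℤP.drop‿+≤+

≰-suc : ∀ {h j} → + suc j ℤ.≤ h → h ≢ + j
≰-suc le refl = 1+n≰n le

≤∧≢⇒suc≤ : ∀ {i j} → i ℤ.≤ j → j ≢ i → + 1 ℤ.+ i ℤ.≤ j
≤∧≢⇒suc≤ le ne = ℤP.i<j⇒suc[i]≤j (ℤP.≤∧≢⇒< le (ne ∘ sym))

1+-cancel-≤ : ∀ {i j} → + 1 ℤ.+ i ℤ.≤ + 1 ℤ.+ j → i ℤ.≤ j
1+-cancel-≤ {i} {j} le = ≤-by le (eq i j)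
  where
  eq : ∀ i j → j ℤ.- i ≡ (+ 1 ℤ.+ j) ℤ.- (+ 1 ℤ.+ i)
  eq = solve-∀

-- Labelled scans and the valleys they contain.

Letter Row : Set
Letter = Step × ℤ
Row = ℤ × ℤ

-- Generic in the letter, so that labelled and bare scans share it; the nested tests copy those of
-- `scan`, with which it agrees by computation.
emit : {B : Set} → B → B → ℤ → ℤ → ℤ → List B
emit p q x y a = if a == x then p ∷ [] else (if a == y then q ∷ [] else [])

emitRow : ℕ → Row → List Letter
emitRow j (y , h) = emit (N , y) (E , y) (+ j) (+ suc j) h

-- The scan S⁺, each letter keeping the label of its row.
lscan : ℕ → List Row → List Letter
lscan j = concatMap (emitRow j)

data Emitted (j : ℕ) (y h : ℤ) : Set where
  emitsN : h ≡ + j → emitRow j (y , h) ≡ (N , y) ∷ [] → Emitted j y h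
  emitsE : h ≡ + suc j → emitRow j (y , h) ≡ (E , y) ∷ [] → Emitted j y h
  silent : h ≢ + j → h ≢ + suc j → emitRow j (y , h) ≡ [] → Emitted j y h

emitted : ∀ j y h → Emitted j y h
emitted j y h with h ℤ.≟ + j in e₁
... | yes p = emitsN p helper
  where
  helper : emitRow j (y , h) ≡ (N , y) ∷ []
  helper rewrite e₁ = refl
... | no ¬p with h ℤ.≟ + suc j in e₂
...   | yes q = emitsE q helper
  where
  helper : emitRow j (y , h) ≡ (E , y) ∷ []
  helper rewrite e₁ | e₂ = refl
...   | no ¬q = silent ¬p ¬q helper
  where
  helper : emitRow j (y , h) ≡ []
  helper rewrite e₁ | e₂ = refl

lscan-∷ : ∀ j r X {e} → emitRow j r ≡ e → lscan j (r ∷ X) ≡ e ++ lscan j X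
lscan-∷ j r X eq = cong (_++ lscan j X) eq

data Adjacent (s t : Letter) : List Letter → Set where
  now   : ∀ {L} → Adjacent s t (s ∷ t ∷ L)
  later : ∀ {r L} → Adjacent s t L → Adjacent s t (r ∷ L)

Adjacent-++⁺ˡ : ∀ {s t L} K → Adjacent s t L → Adjacent s t (L ++ K)
Adjacent-++⁺ˡ K now = now
Adjacent-++⁺ˡ K (later a) = later (Adjacent-++⁺ˡ K a)

Adjacent-++⁺ʳ : ∀ {s t L} K → Adjacent s t L → Adjacent s t (K ++ L)
Adjacent-++⁺ʳ [] a = a
Adjacent-++⁺ʳ (_ ∷ K) a = later (Adjacent-++⁺ʳ K a)

-- `G y z` stands for the condition to be proved for the label y of an E and the label z of the N
-- directly after it. It is kept abstract here, since only the behaviour of the heights matters for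
-- scans.
module Valley (G : ℤ → ℤ → Set) where

  Descends : Row → Row → Set
  Descends (y , h) (z , h′) = h ℤ.≤ + 1 ℤ.+ h′ × (h ≡ + 1 ℤ.+ h′ → G y z)

  HeadOK : ℤ → List Letter → Set
  HeadOK y [] = ⊤
  HeadOK y ((N , z) ∷ L) = G y z
  HeadOK y ((E , z) ∷ L) = ⊤

  ValleysOK : List Letter → Set
  ValleysOK [] = ⊤
  ValleysOK ((N , _) ∷ L) = ValleysOK L
  ValleysOK ((E , y) ∷ L) = HeadOK y L × ValleysOK L

  ValleysOK-adjacent : ∀ {y z L} → ValleysOK L → Adjacent (E , y) (N , z) L → G y z
  ValleysOK-adjacent (g , _) now = g
  ValleysOK-adjacent {L = (N , _) ∷ _} ok (later a) = ValleysOK-adjacent ok a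
  ValleysOK-adjacent {L = (E , _) ∷ _} (_ , ok) (later a) = ValleysOK-adjacent ok a

LastLe : ℤ → List Row → Set
LastLe b [] = ⊤
LastLe b ((_ , h) ∷ []) = h ℤ.≤ b
LastLe b (_ ∷ r ∷ X) = LastLe b (r ∷ X)

LastLe-tail : ∀ {b r} X → LastLe b (r ∷ X) → LastLe b X
LastLe-tail [] _ = tt
LastLe-tail (_ ∷ _) l = l

LastLe-weaken : ∀ {b b′} X → b ℤ.≤ b′ → LastLe b X → LastLe b′ X
LastLe-weaken [] le l = tt
LastLe-weaken (_ ∷ []) le l = ℤP.≤-trans l le
LastLe-weaken (_ ∷ r ∷ X) le l = LastLe-weaken (r ∷ X) le l

module _ {G : ℤ → ℤ → Set} where
  open Valley G

  -- Descending by at most one, the heights meet j+1 before they meet j.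
  HeadOK-scan : ∀ j y r X L → + suc j ℤ.≤ proj₂ r → Linked Descends (r ∷ X) →
    LastLe (+ suc j) (r ∷ X) ⊎ HeadOK y L → HeadOK y (lscan j (r ∷ X) ++ L)
  HeadOK-scan j y (z , h) X L le lk last with emitted j z h
  ... | emitsN h≡ _ = ⊥-elim (≰-suc le h≡)
  ... | emitsE _ eq rewrite lscan-∷ j (z , h) X eq = tt
  HeadOK-scan j y (z , h) [] L le lk (inj₁ last) | silent _ ¬E _ = ⊥-elim (¬E (ℤP.≤-antisym last le))
  HeadOK-scan j y (z , h) [] L le lk (inj₂ ok) | silent _ _ eq
    rewrite lscan-∷ j (z , h) [] eq = ok
  HeadOK-scan j y (z , h) ((z′ , h′) ∷ X) L le ((d , _) ∷ lk) last | silent _ ¬E eq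
    rewrite lscan-∷ j (z , h) ((z′ , h′) ∷ X) eq =
    HeadOK-scan j y (z′ , h′) X L (1+-cancel-≤ (ℤP.≤-trans (≤∧≢⇒suc≤ le ¬E) d)) lk last

  -- Two ways to control the seam between a scan and the word `L` after it. Either the last height
  -- is at most j, so that every E is followed by another letter of the same scan, or `L` begins
  -- acceptably after any row.
  LastOK : ℕ → List Letter → List Row → Set
  LastOK j L X = LastLe (+ j) X ⊎ All (λ r → HeadOK (proj₁ r) L) X

  LastOK-tail : ∀ {j L r} X → LastOK j L (r ∷ X) → LastOK j L X
  LastOK-tail X (inj₁ l) = inj₁ (LastLe-tail X l)
  LastOK-tail X (inj₂ (_ ∷ o)) = inj₂ o

  -- After an E, written at height j + 1, the next row has height at least j. Height j is a drop by
  -- exactly one and yields `G`, height j + 1 gives another E, and for greater heights `HeadOK-scan`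
  -- finds an E before any N.
  ValleysOK-scan : ∀ j X L → Linked Descends X → LastOK j L X → ValleysOK L →
    ValleysOK (lscan j X ++ L)
  ValleysOK-scan j [] L lk last ok = ok
  ValleysOK-scan j ((y , h) ∷ X) L lk last ok with emitted j y h
  ... | emitsN _ eq rewrite lscan-∷ j (y , h) X eq =
    ValleysOK-scan j X L (Linked.tail lk) (LastOK-tail {L = L} X last) ok
  ... | silent _ _ eq rewrite lscan-∷ j (y , h) X eq =
    ValleysOK-scan j X L (Linked.tail lk) (LastOK-tail {L = L} X last) ok
  ... | emitsE h≡ eq rewrite lscan-∷ j (y , h) X eq =
    headOK X lk last , ValleysOK-scan j X L (Linked.tail lk) (LastOK-tail {L = L} X last) ok
    where
    headOK : ∀ X → Linked Descends ((y , h) ∷ X) → LastOK j L ((y , h) ∷ X) → HeadOK y (lscan j X ++ L)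
    headOK [] _ (inj₁ l) = ⊥-elim (1+n≰n (subst (ℤ._≤ + j) h≡ l))
    headOK [] _ (inj₂ (o ∷ _)) = o
    headOK ((z , h′) ∷ X) ((d , drop) ∷ lk) last with emitted j z h′
    ... | emitsN h′≡ eq rewrite lscan-∷ j (z , h′) X eq = drop (trans h≡ (cong ℤ.suc (sym h′≡)))
    ... | emitsE _ eq rewrite lscan-∷ j (z , h′) X eq = tt
    ... | silent ¬N ¬E eq = HeadOK-scan j y (z , h′) X L
      (≤∧≢⇒suc≤ (1+-cancel-≤ (subst (ℤ._≤ _) h≡ d)) ¬N) lk (last′ last)
      where
      last′ : LastOK j L ((y , h) ∷ (z , h′) ∷ X) → LastLe (+ suc j) ((z , h′) ∷ X) ⊎ HeadOK y L
      last′ (inj₁ l) = inj₁ (LastLe-weaken ((z , h′) ∷ X) (ℤ.+≤+ (ℕP.n≤1+n j)) l)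
      last′ (inj₂ (o ∷ _)) = inj₂ o

lscan-++ : ∀ j X Y → lscan j (X ++ Y) ≡ lscan j X ++ lscan j Y
lscan-++ j = concatMap-++ (emitRow j)

emitRow-E : ∀ j y {h} → h ≡ + suc j → emitRow j (y , h) ≡ (E , y) ∷ []
emitRow-E j y {h} h≡ with emitted j y h
... | emitsN h≡′ _ = ⊥-elim (≰-suc (ℤP.≤-reflexive (sym h≡)) h≡′)
... | emitsE _ eq = eq
... | silent _ ¬E _ = ⊥-elim (¬E h≡)

emitRow-N : ∀ j y {h} → h ≡ + j → emitRow j (y , h) ≡ (N , y) ∷ []
emitRow-N j y {h} h≡ with emitted j y h
... | emitsN _ eq = eq
... | emitsE h≡′ _ = ⊥-elim (≰-suc (ℤP.≤-reflexive (sym h≡′)) h≡)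
... | silent ¬N _ _ = ⊥-elim (¬N h≡)

scan-drop : ∀ j X {y z h h′ Y} → h ≡ + suc j → h′ ≡ + j →
  Adjacent (E , y) (N , z) (lscan j (X ++ (y , h) ∷ (z , h′) ∷ Y))
scan-drop j X {y} {z} {h} {h′} {Y} h≡ h′≡
  rewrite lscan-++ j X ((y , h) ∷ (z , h′) ∷ Y) | emitRow-E j y h≡ | emitRow-N j z h′≡ =
  Adjacent-++⁺ʳ (lscan j X) now

-- Labels of the N's and of the E's of a scan.

level : ℤ → List Row → List ℤ
level x = concatMap (λ r → if (proj₂ r == x) then proj₁ r ∷ [] else [])

labels : Step → List Letter → List ℤ
labels s [] = []
labels N ((N , y) ∷ L) = y ∷ labels N L
labels N ((E , _) ∷ L) = labels N L
labels E ((N , _) ∷ L) = labels E L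
labels E ((E , y) ∷ L) = y ∷ labels E L

labels-++ : ∀ s K L → labels s (K ++ L) ≡ labels s K ++ labels s L
labels-++ N [] L = refl
labels-++ E [] L = refl
labels-++ N ((N , y) ∷ K) L = cong (y ∷_) (labels-++ N K L)
labels-++ N ((E , _) ∷ K) L = labels-++ N K L
labels-++ E ((N , _) ∷ K) L = labels-++ E K L
labels-++ E ((E , y) ∷ K) L = cong (y ∷_) (labels-++ E K L)

labelsN-lscan : ∀ j X → labels N (lscan j X) ≡ level (+ j) X
labelsN-lscan j [] = refl
labelsN-lscan j ((y , h) ∷ X) =
  trans (labels-++ N (emitRow j (y , h)) (lscan j X)) (cong₂ _++_ row (labelsN-lscan j X))
  where
  row : labels N (emitRow j (y , h)) ≡ (if (h == (+ j)) then y ∷ [] else [])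
  row with h ℤ.≟ + j
  ... | yes _ = refl
  ... | no _ with h ℤ.≟ + suc j
  ...   | yes _ = refl
  ...   | no _ = refl

labelsE-lscan : ∀ j X → labels E (lscan j X) ≡ level (+ suc j) X
labelsE-lscan j [] = refl
labelsE-lscan j ((y , h) ∷ X) =
  trans (labels-++ E (emitRow j (y , h)) (lscan j X)) (cong₂ _++_ row (labelsE-lscan j X))
  where
  row : labels E (emitRow j (y , h)) ≡ (if (h == (+ suc j)) then y ∷ [] else [])
  row with h ℤ.≟ + j | h ℤ.≟ + suc j
  ... | yes p | yes q = ⊥-elim (≰-suc (ℤP.≤-reflexive (sym q)) p)
  ... | yes _ | no _ = refl
  ... | no _ | yes _ = refl
  ... | no _ | no _ = refl

-- The labelled word and its successive labels.

module Path (A⁺ A⁻ : List Row) where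

  -- path j is ζ_B before the deletion of the last letter, restricted to the scans S_j, ..., S_0.
  body path : ℕ → List Letter
  body zero = (N , + 0) ∷ lscan 0 A⁺
  body (suc j) = lscan (suc j) A⁺ ++ path j
  path j = lscan j A⁻ ++ body j

  -- The window of d_B read backwards, as `reverse-window` shows later.
  levels : ℕ → List ℤ
  levels zero = level (+ 1) A⁺ ++ level (+ 0) A⁻
  levels (suc j) = level (+ suc (suc j)) A⁺ ++ level (+ suc j) A⁻ ++ levels j

  -- The E's of S⁺ number j come from height j + 1 and those of S⁻ number j - 1 from height j, which
  -- are the pieces of `levels`. Only `level (+ 0) A⁻` is written by no E, hence appended.
  labelsE-body : ∀ j → labels E (body j) ++ level (+ 0) A⁻ ≡ levels j
  labelsE-body zero = cong (_++ level (+ 0) A⁻) (labelsE-lscan 0 A⁺)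
  labelsE-body (suc j)
    rewrite labels-++ E (lscan (suc j) A⁺) (path j) | labels-++ E (lscan j A⁻) (body j)
          | labelsE-lscan (suc j) A⁺ | labelsE-lscan j A⁻
          | ++-assoc (level (+ suc (suc j)) A⁺) (level (+ suc j) A⁻ ++ labels E (body j)) (level (+ 0) A⁻)
          | ++-assoc (level (+ suc j) A⁻) (labels E (body j)) (level (+ 0) A⁻)
          | labelsE-body j = refl

  -- Each row writes its N one scan index above its E. The N's therefore run through the same pieces
  -- as the E's with the index shifted by one, and continue past the central N.
  labelsN-body : ∀ j → labels N (body (suc j)) ≡ levels j ++ + 0 ∷ level (+ 0) A⁺
  labelsN-body zero
    rewrite labels-++ N (lscan 1 A⁺) (path 0) | labels-++ N (lscan 0 A⁻) (body 0)
          | labelsN-lscan 1 A⁺ | labelsN-lscan 0 A⁻ | labelsN-lscan 0 A⁺ =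
    sym (++-assoc (level (+ 1) A⁺) _ _)
  labelsN-body (suc j)
    rewrite labels-++ N (lscan (suc (suc j)) A⁺) (path (suc j)) | labels-++ N (lscan (suc j) A⁻) (body (suc j))
          | labelsN-lscan (suc (suc j)) A⁺ | labelsN-lscan (suc j) A⁻ | labelsN-body j
          | ++-assoc (level (+ suc (suc j)) A⁺) (level (+ suc j) A⁻ ++ levels j) (+ 0 ∷ level (+ 0) A⁺)
          | ++-assoc (level (+ suc j) A⁻) (levels j) (+ 0 ∷ level (+ 0) A⁺) = refl

  labelsE-path : ∀ M → level (+ suc M) A⁻ ≡ [] → labels E (path M) ++ level (+ 0) A⁻ ≡ levels M
  labelsE-path M e rewrite labels-++ E (lscan M A⁻) (body M) | labelsE-lscan M A⁻ | e = labelsE-body M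

  labelsN-path : ∀ m → level (+ suc (suc m)) A⁺ ≡ [] →
    labels N (path (suc m)) ≡ levels (suc m) ++ + 0 ∷ level (+ 0) A⁺
  labelsN-path m e
    rewrite labels-++ N (lscan (suc m) A⁻) (body (suc m)) | labelsN-lscan (suc m) A⁻ | labelsN-body m | e =
    sym (++-assoc (level (+ suc m) A⁻) (levels m) _)

  Adjacent-path : ∀ {s t j k} → j ℕ.≤′ k → Adjacent s t (path j) → Adjacent s t (path k)
  Adjacent-path ℕ.≤′-refl a = a
  Adjacent-path (ℕ.≤′-step {k} le) a =
    Adjacent-++⁺ʳ (lscan (suc k) A⁻) (Adjacent-++⁺ʳ (lscan (suc k) A⁺) (Adjacent-path le a))

  Adjacent-path⁻ : ∀ {s t j k} → j ≤ k → Adjacent s t (lscan j A⁻) → Adjacent s t (path k)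
  Adjacent-path⁻ {j = j} le a = Adjacent-path (ℕP.≤⇒≤′ le) (Adjacent-++⁺ˡ (body j) a)

  Adjacent-path⁺ : ∀ {s t j k} → j ≤ k → Adjacent s t (lscan j A⁺) → Adjacent s t (path k)
  Adjacent-path⁺ {j = zero} le a = Adjacent-path (ℕP.≤⇒≤′ le) (Adjacent-++⁺ʳ (lscan 0 A⁻) (later a))
  Adjacent-path⁺ {j = suc j} le a =
    Adjacent-path (ℕP.≤⇒≤′ le) (Adjacent-++⁺ʳ (lscan (suc j) A⁻) (Adjacent-++⁺ˡ (path j) a))

  -- The part of path j before the central N.
  initial : ℕ → List Letter
  initial zero = lscan 0 A⁻
  initial (suc j) = lscan (suc j) A⁻ ++ lscan (suc j) A⁺ ++ initial j

  path-initial : ∀ j → path j ≡ initial j ++ (N , + 0) ∷ lscan 0 A⁺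
  path-initial zero = refl
  path-initial (suc j)
    rewrite path-initial j
          | ++-assoc (lscan (suc j) A⁻) (lscan (suc j) A⁺ ++ initial j) ((N , + 0) ∷ lscan 0 A⁺)
          | ++-assoc (lscan (suc j) A⁺) (initial j) ((N , + 0) ∷ lscan 0 A⁺) = refl

  module _ {G : ℤ → ℤ → Set}
    (G-zero : ∀ y → G y (+ 0))
    (descends⁺ : Linked (Valley.Descends G) A⁺) (descends⁻ : Linked (Valley.Descends G) A⁻)
    (last⁻ : LastLe (+ 1) A⁻)
    (junction : ∀ j L → LastOK {G} (suc j) (lscan j A⁻ ++ L) A⁺) where

    open Valley G

    -- Four kinds of seams occur. S⁻ number 0 meets the central N, accepted by `G-zero`; any other
    -- S⁻ ends at height at most 1, so nothing crosses its seam; S⁺ number j + 1 meets S⁻ number j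
    -- as described by `junction`; S⁺ number 0 ends the word.
    ValleysOK-path : ∀ j → ValleysOK (path j)
    ValleysOK-path zero =
      ValleysOK-scan 0 A⁻ (body 0) descends⁻ (inj₂ (All.universal (λ r → G-zero (proj₁ r)) A⁻))
        (subst ValleysOK (++-identityʳ (lscan 0 A⁺))
          (ValleysOK-scan 0 A⁺ [] descends⁺ (inj₂ (All.universal (λ _ → tt) A⁺)) tt))
    ValleysOK-path (suc j) =
      ValleysOK-scan (suc j) A⁻ (body (suc j)) descends⁻ (inj₁ (LastLe-weaken A⁻ (ℤ.+≤+ (s≤s z≤n)) last⁻))
        (ValleysOK-scan (suc j) A⁺ (path j) descends⁺ (junction j (body j)) (ValleysOK-path j))

  module _ {Q : Letter → Set} (q⁺ : ∀ j → All Q (lscan j A⁺)) (q⁻ : ∀ j → All Q (lscan j A⁻)) (q₀ : Q (N , + 0)) where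

    All-path : ∀ j → All Q (path j)
    All-path zero = AllP.++⁺ (q⁻ 0) (q₀ ∷ q⁺ 0)
    All-path (suc j) = AllP.++⁺ (q⁻ (suc j)) (AllP.++⁺ (q⁺ (suc j)) (All-path j))

-- Valleys of labelled words

-- The only way in which deleting the last letter creates a valley: the first of two final E's
-- becomes the last step, and a final E counts as a valley.
data EndsEE (y y′ : ℤ) : List Letter → Set where
  end   : EndsEE y y′ ((E , y) ∷ (E , y′) ∷ [])
  later : ∀ {r L} → EndsEE y y′ L → EndsEE y y′ (r ∷ L)

-- The given N is neither of the two final E's, so both lie after it.
EndsEE-++-N : ∀ {y y′ o} K {L} → EndsEE y y′ (K ++ (N , o) ∷ L) → EndsEE y y′ L
EndsEE-++-N [] (later e) = e
EndsEE-++-N (_ ∷ []) (later e) = EndsEE-++-N [] e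
EndsEE-++-N (_ ∷ r ∷ []) (later e) = EndsEE-++-N (r ∷ []) e
EndsEE-++-N (_ ∷ r ∷ s ∷ K) (later e) = EndsEE-++-N (r ∷ s ∷ K) e

EndsEE-∈ : ∀ {y y′ L} → EndsEE y y′ L → ((E , y) ∈ L) × ((E , y′) ∈ L)
EndsEE-∈ end = here refl , there (here refl)
EndsEE-∈ (later e) with EndsEE-∈ e
... | p , q = there p , there q

word : List Letter → List Step
word L = dropLast (map proj₁ L)

-- One sequence serves the E's and the N's alike, because both coordinates of a valley are labelled
-- by the same rule. It is indexed from 0, while valleys count steps from 1.
module Labelling (lab : ℕ → ℤ) where

  LabelledFrom : ℕ → List ℤ → Set
  LabelledFrom i [] = ⊤
  LabelledFrom i (x ∷ xs) = lab i ≡ x × LabelledFrom (suc i) xs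

  -- Here `ys` is the part of the label sequence that the word does not reach, so that E's and N's
  -- can be matched with initial segments of the same list.
  labelledFrom-++ : ∀ i xs {ys} → (∀ k → lab (k ℕ.+ i) ≡ nth (xs ++ ys) k) → LabelledFrom i xs
  labelledFrom-++ i [] eq = tt
  labelledFrom-++ i (x ∷ xs) eq =
    eq 0 , labelledFrom-++ (suc i) xs (λ k → trans (cong lab (ℕP.+-suc k i)) (eq (suc k)))

  Labelled : ℕ → ℕ → List Letter → Set
  Labelled i j L = LabelledFrom i (labels E L) × LabelledFrom j (labels N L)

  ValleyAt : ℕ → ℕ → List Step → ℤ → ℤ → Set
  ValleyAt i j β y z =
    ∃₂ λ p q → ((suc p , suc q) ∈ valleysFrom i j β) × (lab p ≡ y) × (lab q ≡ z)

  valleysFrom-E : ∀ {i j v} β → v ∈ valleysFrom (suc i) j β → v ∈ valleysFrom i j (E ∷ β)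
  valleysFrom-E (E ∷ β) m = m
  valleysFrom-E (N ∷ β) m = there m

  adjacent⇒valley : ∀ {y z L i j} → Adjacent (E , y) (N , z) L → Labelled i j L →
    ValleyAt i j (word L) y z
  -- The N is the deleted letter. The E is then final and yields the same pair by the convention for
  -- a path ending with E.
  adjacent⇒valley {L = _ ∷ _ ∷ []} {i} {j} now ((p , _) , (q , _)) = i , j , here refl , p , q
  adjacent⇒valley {L = _ ∷ _ ∷ _ ∷ _} {i} {j} now ((p , _) , (q , _)) = i , j , here refl , p , q
  adjacent⇒valley {L = (E , _) ∷ L@(_ ∷ _)} (later a) ((_ , e) , n)
    with p , q , m , eq , eq′ ← adjacent⇒valley a (e , n) = p , q , valleysFrom-E (word L) m , eq , eq′
  adjacent⇒valley {L = (N , _) ∷ L@(_ ∷ _)} (later a) (e , (_ , n)) = adjacent⇒valley a (e , n)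

  -- In the case `final` all letters except the last two have been counted, which fixes p′ + q′.
  -- This makes the label at q′ the negative of the label of the deleted E once the labels are
  -- antisymmetric.
  data ValleyOrigin (i j p q : ℕ) (L : List Letter) : Set where
    adjacent : ∀ {p′ q′} → p ≡ suc p′ → q ≡ suc q′ → Adjacent (E , lab p′) (N , lab q′) L →
      ValleyOrigin i j p q L
    final : ∀ {p′ q′} → p ≡ suc p′ → q ≡ suc q′ → EndsEE (lab p′) (lab (suc p′)) L →
      suc (suc (p′ ℕ.+ q′)) ≡ i ℕ.+ j ℕ.+ length L → ValleyOrigin i j p q L

  later-E : ∀ {i j p q L y} → ValleyOrigin (suc i) j p q L → ValleyOrigin i j p q ((E , y) ∷ L)
  later-E (adjacent p q a) = adjacent p q (later a)
  later-E {i} {j} {L = L} (final p q e len) =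
    final p q (later e) (trans len (sym (ℕP.+-suc (i ℕ.+ j) (length L))))

  later-N : ∀ {i j p q L y} → ValleyOrigin i (suc j) p q L → ValleyOrigin i j p q ((N , y) ∷ L)
  later-N (adjacent p q a) = adjacent p q (later a)
  later-N {i} {j} {L = L} (final p q e len) = final p q (later e)
    (trans len (trans (cong (ℕ._+ length L) (ℕP.+-suc i j)) (sym (ℕP.+-suc (i ℕ.+ j) (length L)))))

  valley⇒origin : ∀ {i j p q} L → (p , q) ∈ valleysFrom i j (word L) → Labelled i j L →
    ValleyOrigin i j p q L
  valley⇒origin {i} {j} ((E , y) ∷ (E , y′) ∷ []) (here refl) ((refl , refl , _) , n) =
    final {p′ = i} {q′ = j} refl refl end (ℕP.+-comm 2 (i ℕ.+ j))
  valley⇒origin ((E , y) ∷ (N , z) ∷ []) (here refl) ((refl , _) , (refl , _)) =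
    adjacent refl refl now
  valley⇒origin ((E , y) ∷ (N , z) ∷ _ ∷ _) (here refl) ((refl , _) , (refl , _)) =
    adjacent refl refl now
  valley⇒origin ((E , y) ∷ L@((N , z) ∷ _ ∷ _)) (there m) ((_ , e) , n) =
    later-E (valley⇒origin L m (e , n))
  valley⇒origin ((E , y) ∷ L@((E , z) ∷ _ ∷ _)) m ((_ , e) , n) =
    later-E (valley⇒origin L m (e , n))
  valley⇒origin ((N , y) ∷ L@(_ ∷ _)) m (e , (_ , n)) = later-N (valley⇒origin L m (e , n))

-- Labels of successive steps

nth-ʳ++-length : ∀ w ys m → nth (w ʳ++ ys) (length w ℕ.+ m) ≡ nth ys m
nth-ʳ++-length [] ys m = refl
nth-ʳ++-length (x ∷ w) ys m rewrite sym (ℕP.+-suc (length w) m) = nth-ʳ++-length w (x ∷ ys) (suc m)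

nth-ʳ++ : ∀ w ys m → m < length w → nth (w ʳ++ ys) (length w ℕ.∸ suc m) ≡ nth w m
nth-ʳ++ (x ∷ w) ys zero m< =
  trans (cong (nth (w ʳ++ x ∷ ys)) (sym (ℕP.+-identityʳ (length w)))) (nth-ʳ++-length w (x ∷ ys) 0)
nth-ʳ++ (x ∷ w) ys (suc m) (s≤s m<) = nth-ʳ++ w (x ∷ ys) m m<

nth-neg : ∀ w m → nth (map -_ w) m ≡ - nth w m
nth-neg [] m = refl
nth-neg (x ∷ w) zero = refl
nth-neg (x ∷ w) (suc m) = nth-neg w m

-- w(n), ..., w(1), w(0), w(-1), ..., w(-n)
unfolded : List ℤ → List ℤ
unfolded w = reverse w ++ + 0 ∷ map -_ w

stepLabel : ℕ → List ℤ → ℕ → ℤ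
stepLabel n w k = evalB w (+ suc n ℤ.- + suc k)

-- The argument of w is n - k with n = `length w`. It is positive, zero or negative according to the
-- side of the central 0 on which position k lies.
stepLabel-unfolded : ∀ w k → stepLabel (length w) w k ≡ nth (unfolded w) k
stepLabel-unfolded w k
  rewrite ℤP.m-n≡m⊖n (suc (length w)) (suc k) | ℤP.[1+m]⊖[1+n]≡m⊖n (length w) k
        | sym (ʳ++-defn w {+ 0 ∷ map -_ w})
  with ℕP.<-cmp k (length w)
... | tri< k< _ _
  rewrite ℤP.⊖-≥ (ℕP.<⇒≤ k<) | ℕP.+-∸-assoc 1 k< =
  trans (sym (nth-ʳ++ w _ m (ℕP.∸-monoʳ-< ℕP.0<1+n k<)))
    (cong (nth (w ʳ++ _)) (trans (cong (length w ℕ.∸_) (sym (ℕP.+-∸-assoc 1 k<))) (ℕP.m∸[m∸n]≡n (ℕP.<⇒≤ k<))))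
  where m = length w ℕ.∸ suc k
... | tri≈ _ refl _
  rewrite ℤP.n⊖n≡0 (length w) =
  sym (trans (cong (nth (w ʳ++ _)) (sym (ℕP.+-identityʳ (length w)))) (nth-ʳ++-length w _ 0))
... | tri> _ _ k> with ℕP.m≤n⇒∃[o]m+o≡n k>
...   | o , refl
  rewrite ℤP.⊖-< k> | sym (ℕP.+-suc (length w) o) | ℕP.m+n∸m≡n (length w) (suc o) =
  sym (trans (nth-ʳ++-length w _ (suc o)) (nth-neg w o))

evalB-neg : ∀ w z → evalB w (- z) ≡ - evalB w z
evalB-neg w (+ zero) = refl
evalB-neg w (+ suc m) = refl
evalB-neg w -[1+ m ] = sym (ℤP.neg-involutive (nth w m))

-- Positions with sum 2n are mirror images about the central 0: the arguments n - k and n - l are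
-- opposite.
stepLabel-antisym : ∀ n w k l → k ℕ.+ l ≡ 2 ℕ.* n → stepLabel n w l ≡ - stepLabel n w k
stepLabel-antisym n w k l eq = trans (cong (evalB w) ℤeq) (evalB-neg w (+ suc n ℤ.- + suc k))
  where
  k+l : + k ℤ.+ + l ≡ + n ℤ.+ + n
  k+l = trans (sym (ℤP.pos-+ k l)) (cong +_ (trans eq (cong (n ℕ.+_) (ℕP.+-identityʳ n))))
  ring : ∀ n k l → (- (+ 1 ℤ.+ n ℤ.- (+ 1 ℤ.+ k))) ℤ.- (+ 1 ℤ.+ n ℤ.- (+ 1 ℤ.+ l)) ≡ (k ℤ.+ l) ℤ.- (n ℤ.+ n)
  ring = solve-∀
  ℤeq : + suc n ℤ.- + suc l ≡ - (+ suc n ℤ.- + suc k)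
  ℤeq = ≡-by (sym k+l) (ring (+ n) (+ k) (+ l))

-- Rows prepared for the scans.

negLabel negHeight : Row → Row
negLabel (y , h) = - y , h
negHeight (y , h) = y , - h

-- Signs and reading directions are absorbed into the rows: S⁺ reads `ascending` and S⁻ reads
-- `descending`, and both become the same left-to-right scan for the heights j and j + 1.
ascending descending : List Row → List Row
ascending = map negLabel
descending = reverse ∘ map negHeight

level-++ : ∀ x X Y → level x (X ++ Y) ≡ level x X ++ level x Y
level-++ x = concatMap-++ _

level-ascending : ∀ x X → level x (ascending X) ≡ map -_ (level x X)
level-ascending x [] = refl
level-ascending x ((y , h) ∷ X) with h ℤ.≟ x
... | yes _ = cong (- y ∷_) (level-ascending x X)
... | no _ = level-ascending x X

level-[] : ∀ {x X} → All (λ r → proj₂ r ≢ x) X → level x X ≡ []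
level-[] [] = refl
level-[] {x} {(y , h) ∷ X} (ne ∷ nes) with h ℤ.≟ x
... | yes p = ⊥-elim (ne p)
... | no _ = level-[] nes

level-reverse : ∀ x X → level x (reverse X) ≡ reverse (level x X)
level-reverse x [] = refl
level-reverse x (r@(y , h) ∷ X) = begin
  level x (reverse (r ∷ X))                     ≡⟨ cong (level x) (reverse-++ (r ∷ []) X) ⟩
  level x (reverse X ++ r ∷ [])                 ≡⟨ level-++ x (reverse X) (r ∷ []) ⟩
  level x (reverse X) ++ level x (r ∷ [])       ≡⟨ cong₂ _++_ (level-reverse x X) (single) ⟩
  reverse (level x X) ++ reverse (level x (r ∷ [])) ≡⟨ reverse-++ (level x (r ∷ [])) (level x X) ⟨
  reverse (level x (r ∷ []) ++ level x X)       ≡⟨ cong reverse (level-++ x (r ∷ []) X) ⟨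
  reverse (level x (r ∷ X))                     ∎
  where
  open ≡-Reasoning
  single : level x (r ∷ []) ≡ reverse (level x (r ∷ []))
  single with h ℤ.≟ x
  ... | yes _ = refl
  ... | no _ = refl

level-negHeight : ∀ x X → level x (map negHeight X) ≡ level (- x) X
level-negHeight x [] = refl
level-negHeight x ((y , h) ∷ X) with - h ℤ.≟ x | h ℤ.≟ - x
... | yes _ | yes _ = cong (y ∷_) (level-negHeight x X)
... | no _ | no _ = level-negHeight x X
... | yes p | no ¬q = ⊥-elim (¬q (trans (sym (ℤP.neg-involutive h)) (cong -_ p)))
... | no ¬p | yes q = ⊥-elim (¬p (trans (cong -_ q) (ℤP.neg-involutive x)))

level-descending : ∀ x X → level x (descending X) ≡ reverse (level (- x) X)
level-descending x X =
  trans (level-reverse x (map negHeight X)) (cong reverse (level-negHeight x X))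

All-lscan : ∀ {Q : Letter → Set} j {X} →
  All (λ r → (proj₂ r ≡ + j → Q (N , proj₁ r)) × (proj₂ r ≡ + suc j → Q (E , proj₁ r))) X →
  All Q (lscan j X)
All-lscan j [] = []
All-lscan j {(y , h) ∷ X} ((qN , qE) ∷ qs) with emitted j y h
... | emitsN p eq rewrite eq = qN p ∷ All-lscan j qs
... | emitsE p eq rewrite eq = qE p ∷ All-lscan j qs
... | silent _ _ eq rewrite eq = All-lscan j qs

length-labels : ∀ L → length L ≡ length (labels E L) ℕ.+ length (labels N L)
length-labels [] = refl
length-labels ((N , _) ∷ L) = trans (cong suc (length-labels L)) (sym (ℕP.+-suc _ _))
length-labels ((E , _) ∷ L) = cong suc (length-labels L)

-- Neighbouring entries and last entries of enumerated lists.

applyUpTo-split : ∀ {A : Set} (f : ℕ → A) n k → suc k < n →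
  ∃₂ λ X Y → applyUpTo f n ≡ X ++ f k ∷ f (suc k) ∷ Y
applyUpTo-split f (suc (suc n)) zero _ = [] , _ , refl
applyUpTo-split f (suc n) (suc k) (s≤s k<) with applyUpTo-split (f ∘ suc) n k k<
... | X , Y , eq = f 0 ∷ X , Y , cong (f 0 ∷_) eq

applyDownFrom-split : ∀ {A : Set} (f : ℕ → A) n k → suc k < n →
  ∃₂ λ X Y → applyDownFrom f n ≡ X ++ f (suc k) ∷ f k ∷ Y
applyDownFrom-split f n k k< with applyUpTo-split f n k k<
... | X , Y , eq = reverse Y , reverse X , (begin
  applyDownFrom f n                                ≡⟨ reverse-applyUpTo f n ⟨
  reverse (applyUpTo f n)                          ≡⟨ cong reverse eq ⟩
  reverse (X ++ f k ∷ f (suc k) ∷ Y)               ≡⟨ reverse-++ X _ ⟩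
  reverse (f k ∷ f (suc k) ∷ Y) ++ reverse X       ≡⟨ cong (_++ reverse X) (reverse-++ (f k ∷ f (suc k) ∷ []) Y) ⟩
  (reverse Y ++ f (suc k) ∷ f k ∷ []) ++ reverse X ≡⟨ ++-assoc (reverse Y) _ _ ⟩
  reverse Y ++ f (suc k) ∷ f k ∷ reverse X         ∎)
  where open ≡-Reasoning

LastLe-applyUpTo : ∀ {b} f n → proj₂ (f n) ℤ.≤ b → LastLe b (applyUpTo f (suc n))
LastLe-applyUpTo f zero le = le
LastLe-applyUpTo f (suc n) le = LastLe-applyUpTo (f ∘ suc) n le

LastLe-applyDownFrom : ∀ {b} f n → proj₂ (f 0) ℤ.≤ b → LastLe b (applyDownFrom f (suc n))
LastLe-applyDownFrom f zero le = le
LastLe-applyDownFrom f (suc n) le = LastLe-applyDownFrom f n le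

-- Valleys of the word of a height sequence.

module Core (m : ℕ) (u c : ℕ → ℤ)
  (step : ∀ k → suc k < suc (suc m) → c k ℤ.≤ + 1 ℤ.+ c (suc k))
  (first : - + 1 ℤ.≤ c 0)
  (last : c (suc m) ℤ.≤ + 1 ℤ.- c m)
  (M : ℕ)
  (lower : ∀ k → k < suc (suc m) → - + suc M ℤ.≤ c k)
  (upper : ∀ k → k < suc (suc m) → c k ℤ.≤ + suc M)
  where

  private
    n : ℕ
    n = suc (suc m)

  row row⁺ row⁻ : ℕ → Row
  row k = u k , c k
  row⁺ k = - u k , c k
  row⁻ k = u k , - c k

  rows : List Row
  rows = applyUpTo row n

  A⁺ A⁻ : List Row
  A⁺ = ascending rows
  A⁻ = descending rows

  A⁺≡ : A⁺ ≡ applyUpTo row⁺ n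
  A⁺≡ = map-applyUpTo row negLabel n

  A⁻≡ : A⁻ ≡ applyDownFrom row⁻ n
  A⁻≡ = trans (cong reverse (map-applyUpTo row negHeight n)) (reverse-applyUpTo row⁻ n)

  open Path A⁺ A⁻ public

  -- Expressed by the heights alone; `rise⇔` identifies these drops with the rises of π.
  RiseAt : ℕ → Set
  RiseAt k = suc k < n × c k ≡ + 1 ℤ.+ c (suc k)

  -- The two forms of a drop belong to the leftward scans S⁻ and to the rightward scans S⁺. The
  -- alternative z = 0 admits the central N.
  G : ℤ → ℤ → Set
  G y z = (∃[ k ] RiseAt k × ((y ≡ u (suc k) × z ≡ u k) ⊎ (y ≡ - u k × z ≡ - u (suc k)))) ⊎ z ≡ + 0

  open Valley G

  descends⁺ : Linked Descends A⁺
  descends⁺ = subst (Linked Descends) (sym A⁺≡) (LinkedP.applyUpTo⁺₁ row⁺ n λ {k} k< →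
    step k k< , λ eq → inj₁ (k , (k< , eq) , inj₂ (refl , refl)))

  flip-step : ∀ a b → (+ 1 ℤ.+ - a) ℤ.- - b ≡ (+ 1 ℤ.+ b) ℤ.- a
  flip-step = solve-∀

  flip-step′ : ∀ a b → (+ 1 ℤ.+ b) ℤ.- a ≡ (+ 1 ℤ.+ - a) ℤ.- - b
  flip-step′ = solve-∀

  descends⁻ : Linked Descends A⁻
  descends⁻ = subst (Linked Descends) (sym A⁻≡) (LinkedP.applyDownFrom⁺₁ row⁻ n λ {k} k< →
    ≤-by (step k k<) (flip-step (c k) (c (suc k))) ,
    λ eq → inj₁ (k , (k< , ≡-by eq (flip-step′ (c k) (c (suc k)))) , inj₁ (refl , refl)))

  last⁻ : LastLe (+ 1) A⁻
  last⁻ = subst (LastLe (+ 1)) (sym A⁻≡)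
    (LastLe-applyDownFrom row⁻ (suc m) (ℤP.neg-mono-≤ first))

  -- If the last height c_n exceeds j + 1, then c_{n-1} ≤ - j - 1, so the next letter is an E.
  junction : ∀ j L → LastOK {G} (suc j) (lscan j A⁻ ++ L) A⁺
  junction j L with c (suc m) ℤ.≤? + suc j
  ... | yes le = inj₁ (subst (LastLe (+ suc j)) (sym A⁺≡) (LastLe-applyUpTo row⁺ (suc m) le))
  ... | no ¬le = inj₂ (All.universal (λ r → headOK (proj₁ r)) A⁺)
    where
    big : + suc (suc j) ℤ.≤ c (suc m)
    big = ℤP.i<j⇒suc[i]≤j (ℤP.≰⇒> ¬le)
    0<c : + 0 ℤ.< c (suc m)
    0<c = ℤP.<-≤-trans (ℤ.+<+ (s≤s z≤n)) big
    ring : ∀ a j → (- a) ℤ.- (+ 1 ℤ.+ j) ≡ (+ 1 ℤ.- a) ℤ.- (+ 1 ℤ.+ (+ 1 ℤ.+ j))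
    ring = solve-∀
    lk : Linked Descends (applyDownFrom row⁻ n)
    lk = subst (Linked Descends) A⁻≡ descends⁻
    X = applyDownFrom row⁻ m
    headOK : ∀ y → HeadOK y (lscan j A⁻ ++ L)
    headOK y = subst (λ A → HeadOK y (lscan j A ++ L)) (sym A⁻≡) headOK′
      where
      headOK′ : HeadOK y (lscan j (applyDownFrom row⁻ n) ++ L)
      headOK′ with emitted j (u (suc m)) (- c (suc m))
      -- Row n is read first and has negative height in `A⁻`, since c_n is positive; so it writes
      -- nothing.
      ... | emitsN h≡ _ = ⊥-elim (ℤP.<⇒≱ (ℤP.neg-mono-< 0<c) (subst (+ 0 ℤ.≤_) (sym h≡) (ℤ.+≤+ z≤n)))
      ... | emitsE h≡ _ = ⊥-elim (ℤP.<⇒≱ (ℤP.neg-mono-< 0<c) (subst (+ 0 ℤ.≤_) (sym h≡) (ℤ.+≤+ z≤n)))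
      ... | silent _ _ eq rewrite eq = HeadOK-scan j y (u m , - c m) X L
        (≤-by (ℤP.≤-trans big last) (ring (c m) (+ j))) (Linked.tail lk)
        -- The scan ends at height -c_1, which is at most 1 and hence at most j + 1, so an E is met
        -- before it ends.
        (inj₁ (LastLe-applyDownFrom row⁻ m
          (ℤP.≤-trans (ℤP.neg-mono-≤ first) (ℤ.+≤+ (s≤s z≤n)))))

  -- For a drop from -j to -j - 1 the reversal puts row k + 1 before row k, and the negated heights
  -- are j + 1 and j: an E followed by an N.
  adjacent⁻ : ∀ k → RiseAt k → ∀ j → - c k ≡ + j →
    Adjacent (E , u (suc k)) (N , u k) (path (suc M))
  adjacent⁻ k (k< , eq) j ck = Adjacent-path⁻ j≤M adj
    where
    j≤M : j ≤ suc M
    j≤M = ℤP.drop‿+≤+ (subst (ℤ._≤ + suc M) ck (ℤP.neg-mono-≤ (lower k (ℕP.<-trans (ℕP.n<1+n k) k<))))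
    ring : ∀ j a b → (+ 1 ℤ.+ j) ℤ.- - b ≡ (j ℤ.- - a) ℤ.- (a ℤ.- (+ 1 ℤ.+ b))
    ring = solve-∀
    ck+1 : - c (suc k) ≡ + suc j
    ck+1 = sym (ℤP.i-j≡0⇒i≡j _ _ (trans (ring (+ j) (c k) (c (suc k)))
      (cong₂ ℤ._-_ (ℤP.i≡j⇒i-j≡0 (sym ck)) (ℤP.i≡j⇒i-j≡0 eq))))
    adj : Adjacent (E , u (suc k)) (N , u k) (lscan j A⁻)
    adj with applyDownFrom-split row⁻ n k k<
    ... | X , Y , eq = subst (λ A → Adjacent (E , u (suc k)) (N , u k) (lscan j A)) (sym (trans A⁻≡ eq)) (scan-drop j X ck+1 ck)

  adjacent⁺ : ∀ k → RiseAt k → ∀ j → c k ≡ + suc j →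
    Adjacent (E , - u k) (N , - u (suc k)) (path (suc M))
  adjacent⁺ k (k< , eq) j ck = Adjacent-path⁺ j≤M adj
    where
    j≤M : j ≤ suc M
    j≤M = ℕP.≤-trans (ℕP.n≤1+n j) (ℤP.drop‿+≤+ (subst (ℤ._≤ + suc M) ck (upper k (ℕP.<-trans (ℕP.n<1+n k) k<))))
    ring : ∀ j c → j ℤ.- c ≡ (+ 1 ℤ.+ j) ℤ.- (+ 1 ℤ.+ c)
    ring = solve-∀
    ck+1 : c (suc k) ≡ + j
    ck+1 = ≡-by (trans (sym eq) ck) (ring (+ j) (c (suc k)))
    adj : Adjacent (E , - u k) (N , - u (suc k)) (lscan j A⁺)
    adj with applyUpTo-split row⁺ n k k<
    ... | X , Y , eq = subst (λ A → Adjacent (E , - u k) (N , - u (suc k)) (lscan j A)) (sym (trans A⁺≡ eq)) (scan-drop j X ck ck+1)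

  rise-adjacent : ∀ k → RiseAt k →
    Adjacent (E , u (suc k)) (N , u k) (path (suc M)) ⊎ Adjacent (E , - u k) (N , - u (suc k)) (path (suc M))
  rise-adjacent k rise with c k in ck
  ... | + zero = inj₁ (adjacent⁻ k rise′ 0 (cong -_ ck))
    where rise′ = proj₁ rise , trans ck (proj₂ rise)
  ... | -[1+ i ] = inj₁ (adjacent⁻ k rise′ (suc i) (cong -_ ck))
    where rise′ = proj₁ rise , trans ck (proj₂ rise)
  ... | + suc j = inj₂ (adjacent⁺ k rise′ j ck)
    where rise′ = proj₁ rise , trans ck (proj₂ rise)

  -- Row 1 is the last one read by S⁻ number 0. At height -1 it writes an E, right before the
  -- central N.
  first-adjacent : c 0 ≡ - + 1 → Adjacent (E , u 0) (N , + 0) (path (suc M))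
  first-adjacent c0 = Adjacent-path {k = suc M} (ℕP.≤⇒≤′ z≤n) (subst (Adjacent (E , u 0) (N , + 0))
      (sym (trans (cong (_++ body 0) scan₀) (++-assoc (lscan 0 X) ((E , u 0) ∷ []) (body 0))))
      (Adjacent-++⁺ʳ (lscan 0 X) now))
    where
    open ≡-Reasoning
    X = applyDownFrom (row⁻ ∘ suc) (suc m)
    scan₀ : lscan 0 A⁻ ≡ lscan 0 X ++ (E , u 0) ∷ []
    scan₀ = begin
      lscan 0 A⁻                                ≡⟨ cong (lscan 0) (trans A⁻≡ (sym (applyDownFrom-∷ʳ row⁻ (suc m)))) ⟩
      lscan 0 (X ++ row⁻ 0 ∷ [])                ≡⟨ lscan-++ 0 X (row⁻ 0 ∷ []) ⟩
      lscan 0 X ++ lscan 0 (row⁻ 0 ∷ [])        ≡⟨ cong (λ e → lscan 0 X ++ e ++ []) (emitRow-E 0 (u 0) (cong -_ c0)) ⟩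
      lscan 0 X ++ (E , u 0) ∷ []               ∎

  IsU IsNegU : ℤ → Set
  IsU y = ∃[ k ] k < n × y ≡ u k
  IsNegU y = ∃[ k ] k < n × y ≡ - u k

  -- `G` allows any label before the central N. The sign of the height recovers what is lost there:
  -- an E whose label is not negated comes from a leftward scan, hence from a row below 0.
  Origin : Letter → Set
  Origin (N , y) = ⊤
  Origin (E , y) = IsNegU y ⊎ (∃[ k ] k < n × y ≡ u k × c k ℤ.< + 0)

  All-origin : All Origin (path (suc M))
  All-origin = All-path {Q = Origin} q⁺ q⁻ tt (suc M)
    where
    q⁺ : ∀ j → All Origin (lscan j A⁺)
    q⁺ j = All-lscan j (subst (All _) (sym A⁺≡)
      (AllP.applyUpTo⁺₁ row⁺ n λ {k} k< → (λ _ → tt) , λ _ → inj₁ (k , k< , refl)))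
    q⁻ : ∀ j → All Origin (lscan j A⁻)
    q⁻ j = All-lscan j (subst (All _) (sym A⁻≡)
      (AllP.applyDownFrom⁺₁ row⁻ n λ {k} k< → (λ _ → tt) , λ eq → inj₂ (k , k< , refl ,
        ℤP.neg-cancel-< {+ 0} (subst (+ 0 ℤ.<_) (sym eq) (ℤ.+<+ (s≤s z≤n))))))

  -- Only S⁺ number 0 writes after the central N, so two final E's carry negated labels.
  All-scan₀ : All (λ s → IsNegU (proj₂ s)) (lscan 0 A⁺)
  All-scan₀ = All-lscan 0 (subst (All _) (sym A⁺≡)
      (AllP.applyUpTo⁺₁ row⁺ n λ {k} k< → (λ _ → k , k< , refl) , λ _ → k , k< , refl))

  Adjacent-∈ : ∀ {s t L} → Adjacent s t L → s ∈ L
  Adjacent-∈ now = here refl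
  Adjacent-∈ (later a) = there (Adjacent-∈ a)

  module Window (w : List ℤ) (length-w : length w ≡ n) (reverse-w : reverse w ≡ levels (suc M)) where

    L = path (suc M)

    lab : ℕ → ℤ
    lab = stepLabel n w

    open Labelling lab

    level₀ : level (+ 0) A⁺ ≡ map -_ (reverse (level (+ 0) A⁻))
    level₀ = begin
      level (+ 0) A⁺                                 ≡⟨ level-ascending (+ 0) rows ⟩
      map -_ (level (+ 0) rows)                      ≡⟨ cong (map -_) (reverse-involutive _) ⟨
      map -_ (reverse (reverse (level (+ 0) rows)))  ≡⟨ cong (map -_ ∘ reverse) (level-descending (+ 0) rows) ⟨
      map -_ (reverse (level (+ 0) A⁻))              ∎
      where open ≡-Reasoning

    noE : level (+ suc (suc M)) A⁻ ≡ []
    noE = level-[] (subst (All _) (sym A⁻≡) (AllP.applyDownFrom⁺₁ row⁻ n λ {k} k< eq →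
      1+n≰n (subst (ℤ._≤ + suc M) eq (ℤP.neg-mono-≤ (lower k k<)))))

    noN : level (+ suc (suc M)) A⁺ ≡ []
    noN = level-[] (subst (All _) (sym A⁺≡) (AllP.applyUpTo⁺₁ row⁺ n λ {k} k< eq →
      1+n≰n (subst (ℤ._≤ + suc M) eq (upper k k<))))

    east : labels E L ++ level (+ 0) A⁻ ≡ reverse w
    east = trans (labelsE-path (suc M) noE) (sym reverse-w)

    north : labels N L ≡ reverse w ++ + 0 ∷ level (+ 0) A⁺
    north = trans (labelsN-path M noN) (cong (_++ + 0 ∷ level (+ 0) A⁺) (sym reverse-w))

    -- Reversing and negating `east` shows that w(-1), w(-2), ... starts with the labels of the N's
    -- after the central one. Thus the N's keep following `unfolded` beyond its centre.
    unfolded-w : map -_ w ≡ level (+ 0) A⁺ ++ map -_ (reverse (labels E L))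
    unfolded-w = begin
      map -_ w                                                   ≡⟨ cong (map -_) (reverse-involutive w) ⟨
      map -_ (reverse (reverse w))                               ≡⟨ cong (map -_ ∘ reverse) east ⟨
      map -_ (reverse (labels E L ++ level (+ 0) A⁻))            ≡⟨ cong (map -_) (reverse-++ (labels E L) _) ⟩
      map -_ (reverse (level (+ 0) A⁻) ++ reverse (labels E L))  ≡⟨ map-++ -_ (reverse (level (+ 0) A⁻)) _ ⟩
      map -_ (reverse (level (+ 0) A⁻)) ++ map -_ (reverse (labels E L)) ≡⟨ cong (_++ map -_ (reverse (labels E L))) level₀ ⟨
      level (+ 0) A⁺ ++ map -_ (reverse (labels E L))            ∎
      where open ≡-Reasoning

    lab-unfolded : ∀ k → lab k ≡ nth (unfolded w) k
    lab-unfolded k = trans (cong (λ l → stepLabel l w k) (sym length-w)) (stepLabel-unfolded w k)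

    labelled : Labelled 0 0 L
    labelled = labelledFrom-++ 0 (labels E L) {level (+ 0) A⁻ ++ + 0 ∷ map -_ w} (λ k → eq k eqE) ,
               labelledFrom-++ 0 (labels N L) {map -_ (reverse (labels E L))} (λ k → eq k eqN)
      where
      eq : ∀ k {F} → unfolded w ≡ F → lab (k ℕ.+ 0) ≡ nth F k
      eq k refl = trans (cong lab (ℕP.+-identityʳ k)) (lab-unfolded k)
      eqE : unfolded w ≡ labels E L ++ level (+ 0) A⁻ ++ + 0 ∷ map -_ w
      eqE = trans (cong (_++ + 0 ∷ map -_ w) (sym east)) (++-assoc (labels E L) _ _)
      eqN : unfolded w ≡ labels N L ++ map -_ (reverse (labels E L))
      eqN = trans (cong (λ z → reverse w ++ + 0 ∷ z) unfolded-w)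
        (sym (trans (cong (_++ map -_ (reverse (labels E L))) north) (++-assoc (reverse w) _ _)))

    -- With d rows of height 0 there are n - d E's and n + 1 + d N's.
    length-L : length L ≡ suc (2 ℕ.* n)
    length-L = begin
      length L                          ≡⟨ length-labels L ⟩
      e ℕ.+ length (labels N L)         ≡⟨ cong (e ℕ.+_) (trans (cong length north) (length-++ (reverse w))) ⟩
      e ℕ.+ (length (reverse w) ℕ.+ suc (length (level (+ 0) A⁺))) ≡⟨ cong₂ (λ a b → e ℕ.+ (a ℕ.+ suc b)) len-w len₀ ⟩
      e ℕ.+ (n ℕ.+ suc d)               ≡⟨ ring e n d ⟩
      suc (n ℕ.+ (e ℕ.+ d))             ≡⟨ cong (λ z → suc (n ℕ.+ z)) (trans (sym (length-++ (labels E L))) (trans (cong length east) len-w)) ⟩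
      suc (n ℕ.+ n)                     ≡⟨ cong (λ z → suc (n ℕ.+ z)) (ℕP.+-identityʳ n) ⟨
      suc (2 ℕ.* n)                     ∎
      where
      open ≡-Reasoning
      e = length (labels E L)
      d = length (level (+ 0) A⁻)
      len-w : length (reverse w) ≡ n
      len-w = trans (length-reverse w) length-w
      len₀ : length (level (+ 0) A⁺) ≡ d
      len₀ = trans (cong length level₀) (trans (length-map -_ (reverse (level (+ 0) A⁻))) (length-reverse (level (+ 0) A⁻)))
      ring : ∀ e n d → e ℕ.+ (n ℕ.+ suc d) ≡ suc (n ℕ.+ (e ℕ.+ d))
      ring = ℕSolver.solve-∀

    β : List Step
    β = word L

    adjacent⇒label : ∀ {y z} → Adjacent (E , y) (N , z) L → HasValleyLabel n β w y z
    adjacent⇒label a with p , q , mem , eq , eq′ ← adjacent⇒valley a labelled = (suc p , suc q) , mem , eq , eq′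

    rise⇒label : ∀ k → RiseAt k →
      HasValleyLabel n β w (u (suc k)) (u k) ⊎ HasValleyLabel n β w (- u k) (- u (suc k))
    rise⇒label k rise with rise-adjacent k rise
    ... | inj₁ a = inj₁ (adjacent⇒label a)
    ... | inj₂ a = inj₂ (adjacent⇒label a)

    first⇒label : c 0 ≡ - + 1 → HasValleyLabel n β w (u 0) (+ 0)
    first⇒label = adjacent⇒label ∘ first-adjacent

    -- A valley is an E directly before an N, which `ValleysOK` controls, or it is created by the
    -- deletion. In the second case both final E's follow the central N and carry negated labels,
    -- and antisymmetry turns the label of the deleted E into the second label of the valley.
    label⇒ : ∀ {y z} → HasValleyLabel n β w y z → (G y z × Origin (E , y)) ⊎ (IsNegU y × IsU z)
    label⇒ (_ , mem , refl , refl) with valley⇒origin L mem labelled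
    ... | adjacent refl refl a =
      inj₁ (ValleysOK-adjacent ok a , All.lookup All-origin (Adjacent-∈ a))
      where
      ok : ValleysOK L
      ok = ValleysOK-path {G} (λ y → inj₂ refl) descends⁺ descends⁻ last⁻ junction (suc M)
    ... | final {p} {q} refl refl ends len with EndsEE-∈ (EndsEE-++-N (initial (suc M)) (subst (EndsEE _ _) (path-initial (suc M)) ends))
    ...   | y∈ , y′∈ with All.lookup All-scan₀ y′∈
    ...     | k , k< , eq = inj₂ (All.lookup All-scan₀ y∈ , k , k< , (begin
      lab q           ≡⟨ stepLabel-antisym n w (suc p) q (ℕP.suc-injective (trans len length-L)) ⟩
      - lab (suc p)   ≡⟨ cong -_ eq ⟩
      - - u k         ≡⟨ ℤP.neg-involutive (u k) ⟩
      u k             ∎))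
      where open ≡-Reasoning

-- The reflection of heights that exchanges j + 1 and -j.

reflect : ℤ → ℤ
reflect h = + 1 ℤ.- h

==-transport : ∀ a b {x y} → (a ≡ x → b ≡ y) → (b ≡ y → a ≡ x) → (a == x) ≡ (b == y)
==-transport a b {x} {y} f g with a ℤ.≟ x | b ℤ.≟ y
... | yes _ | yes _ = refl
... | no _ | no _ = refl
... | yes p | no ¬q = ⊥-elim (¬q (f p))
... | no ¬p | yes q = ⊥-elim (¬p (g q))

==-neg : ∀ h x → ((- h) == x) ≡ (h == (- x))
==-neg h x = ==-transport (- h) h (λ p → trans (sym (ℤP.neg-involutive h)) (cong -_ p))
                          (λ p → trans (cong -_ p) (ℤP.neg-involutive x))

==-reflect : ∀ h x → (reflect h == x) ≡ (h == (reflect x))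
==-reflect h x = ==-transport (reflect h) h (λ { refl → sym (involutive h) }) (λ { refl → involutive x })
  where
  involutive : ∀ h → + 1 ℤ.- (+ 1 ℤ.- h) ≡ h
  involutive = solve-∀

reflect-+suc : ∀ j → reflect (+ suc j) ≡ - + j
reflect-+suc j = ring (+ j)
  where
  ring : ∀ j → + 1 ℤ.- (+ 1 ℤ.+ j) ≡ - j
  ring = solve-∀

reflect-neg : ∀ j → reflect (- + j) ≡ + suc j
reflect-neg j = ring (+ j)
  where
  ring : ∀ j → + 1 ℤ.- (- j) ≡ + 1 ℤ.+ j
  ring = solve-∀

==-cong : ∀ h {x x′} → x ≡ x′ → (h == x) ≡ (h == x′)
==-cong h refl = refl

-- Invariance of ζ_B under reflection of the last height

letter⁺ letter⁻ : ℕ → ℤ → List Step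
letter⁺ j = emit N E (+ j) (+ suc j)
letter⁻ j = emit N E (- + j) (- + suc j)

emit-cong : ∀ {B : Set} {p q : B} a a′ {x y x′ y′} → (a == x) ≡ (a′ == x′) → (a == y) ≡ (a′ == y′) →
  emit p q x y a ≡ emit p q x′ y′ a′
emit-cong _ _ eq eq′ rewrite eq | eq′ = refl

-- Reflection sends -j and -j - 1 to j + 1 and j + 2, so a letter of S⁻ number j becomes the same
-- letter of S⁺ number j + 1.
letter⁺-reflect : ∀ j h → letter⁺ (suc j) (reflect h) ≡ letter⁻ j h
letter⁺-reflect j h = emit-cong (reflect h) h
  (trans (==-reflect h (+ suc j)) (==-cong h (reflect-+suc j)))
  (trans (==-reflect h (+ suc (suc j))) (==-cong h (reflect-+suc (suc j))))

letter⁻-reflect : ∀ j h → letter⁻ j (reflect h) ≡ letter⁺ (suc j) h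
letter⁻-reflect j h = emit-cong (reflect h) h
  (trans (==-reflect h (- + j)) (==-cong h (reflect-neg j)))
  (trans (==-reflect h (- + suc j)) (==-cong h (reflect-neg (suc j))))

emit-[] : ∀ {B : Set} {p q : B} {x y a} → a ≢ x → a ≢ y → emit p q x y a ≡ []
emit-[] {x = x} {y} {a} ne ne′ with a ℤ.≟ x | a ℤ.≟ y
... | yes p | _ = ⊥-elim (ne p)
... | no _ | yes p = ⊥-elim (ne′ p)
... | no _ | no _ = refl

≤0⇒≢+suc : ∀ {h j} → h ℤ.≤ + 0 → h ≢ + suc j
≤0⇒≢+suc (ℤ.+≤+ ()) refl

≰0⇒≢neg : ∀ {h} j → ¬ (h ℤ.≤ + 0) → h ≢ - + j
≰0⇒≢neg zero ¬le refl = ¬le (ℤ.+≤+ z≤n)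
≰0⇒≢neg (suc j) ¬le refl = ¬le ℤ.-≤+

-- At most one factor is nonempty: the S⁻ letter requires h ≤ 0, the S⁺ letter h > 0.
letters-comm : ∀ j h → letter⁻ j h ++ letter⁺ (suc j) h ≡ letter⁺ (suc j) h ++ letter⁻ j h
letters-comm j h with h ℤ.≤? + 0
... | yes le rewrite emit-[] {p = N} {E} (≤0⇒≢+suc {j = j} le) (≤0⇒≢+suc {j = suc j} le) = ++-identityʳ (letter⁻ j h)
... | no ¬le rewrite emit-[] {p = N} {E} (≰0⇒≢neg j ¬le) (≰0⇒≢neg (suc j) ¬le) = sym (++-identityʳ (letter⁺ (suc j) h))

S⁺-snoc : ∀ j R h → S⁺→ j (R ++ h ∷ []) ≡ S⁺→ j R ++ letter⁺ j h
S⁺-snoc j R h = trans (concatMap-++ (letter⁺ j) R (h ∷ []))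
  (cong (S⁺→ j R ++_) (++-identityʳ (letter⁺ j h)))

S⁻-snoc : ∀ j R h → S⁻← j (R ++ h ∷ []) ≡ letter⁻ j h ++ S⁻← j R
S⁻-snoc j R h = cong (scan (- + j) (- + suc j)) (reverse-++ R (h ∷ []))

-- Groups S⁺ number j + 1 with S⁻ number j. The last row is read last by the former and first by the
-- latter, so its two possible letters share one place.
zetaTail : ℕ → List ℤ → List Step
zetaTail zero a = dropLast (N ∷ S⁺→ 0 a)
zetaTail (suc j) a = S⁺→ (suc j) a ++ S⁻← j a ++ zetaTail j a

zetaWord : ℕ → List ℤ → List Step
zetaWord j a = zetaHigh j a ++ S⁻← 0 a ++ dropLast (N ∷ S⁺→ 0 a)

zetaWord-tail : ∀ j a → zetaWord j a ≡ S⁻← j a ++ zetaTail j a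
zetaWord-tail zero a = refl
zetaWord-tail (suc j) a = begin
  (S⁻← (suc j) a ++ S⁺→ (suc j) a ++ zetaHigh j a) ++ rest  ≡⟨ ++-assoc (S⁻← (suc j) a) _ rest ⟩
  S⁻← (suc j) a ++ (S⁺→ (suc j) a ++ zetaHigh j a) ++ rest  ≡⟨ cong (S⁻← (suc j) a ++_) (++-assoc (S⁺→ (suc j) a) _ rest) ⟩
  S⁻← (suc j) a ++ S⁺→ (suc j) a ++ zetaWord j a            ≡⟨ cong (λ z → S⁻← (suc j) a ++ S⁺→ (suc j) a ++ z) (zetaWord-tail j a) ⟩
  S⁻← (suc j) a ++ zetaTail (suc j) a                       ∎
  where
  open ≡-Reasoning
  rest = S⁻← 0 a ++ dropLast (N ∷ S⁺→ 0 a)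

dropLast-++ : ∀ xs y ys → dropLast (xs ++ y ∷ ys) ≡ xs ++ dropLast (y ∷ ys)
dropLast-++ [] y ys = refl
dropLast-++ (x ∷ []) y ys = refl
dropLast-++ (x ∷ x′ ∷ xs) y ys = cong (x ∷_) (dropLast-++ (x′ ∷ xs) y ys)

dropLast-snoc : ∀ x xs {e e′} → (e ≡ [] × e′ ≡ []) ⊎ (∃₂ λ s s′ → e ≡ s ∷ [] × e′ ≡ s′ ∷ []) →
  dropLast (x ∷ xs ++ e) ≡ dropLast (x ∷ xs ++ e′)
dropLast-snoc x xs (inj₁ (refl , refl)) = refl
dropLast-snoc x xs (inj₂ (s , s′ , refl , refl)) =
  trans (dropLast-++ (x ∷ xs) s []) (sym (dropLast-++ (x ∷ xs) s′ []))

-- At each seam between S⁺ and S⁻ the reflection only swaps the two possible letters of the last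
-- row. In S⁺ number 0 it exchanges heights 0 and 1, which affects only the letter to be deleted.
zetaTail-reflect : ∀ j R h → zetaTail j (R ++ reflect h ∷ []) ≡ zetaTail j (R ++ h ∷ [])
zetaTail-reflect zero R h
  rewrite S⁺-snoc 0 R h | S⁺-snoc 0 R (reflect h) = dropLast-snoc N (S⁺→ 0 R) same
  where
  same : (letter⁺ 0 (reflect h) ≡ [] × letter⁺ 0 h ≡ []) ⊎
    (∃₂ λ s s′ → letter⁺ 0 (reflect h) ≡ s ∷ [] × letter⁺ 0 h ≡ s′ ∷ [])
  same rewrite ==-reflect h (+ 0) | ==-reflect h (+ 1) with h ℤ.≟ + 0 | h ℤ.≟ + 1
  ... | yes refl | yes ()
  ... | yes _ | no _ = inj₂ (_ , _ , refl , refl)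
  ... | no _ | yes _ = inj₂ (_ , _ , refl , refl)
  ... | no _ | no _ = inj₁ (refl , refl)
zetaTail-reflect (suc j) R h
  rewrite S⁺-snoc (suc j) R h | S⁺-snoc (suc j) R (reflect h) | S⁻-snoc j R h | S⁻-snoc j R (reflect h)
        | letter⁺-reflect j h | letter⁻-reflect j h | zetaTail-reflect j R h = begin
  (S⁺ ++ l⁻) ++ (l⁺ ++ S⁻) ++ T  ≡⟨ regroup l⁻ l⁺ ⟩
  S⁺ ++ (l⁻ ++ l⁺) ++ S⁻ ++ T    ≡⟨ cong (λ l → S⁺ ++ l ++ S⁻ ++ T) (letters-comm j h) ⟩
  S⁺ ++ (l⁺ ++ l⁻) ++ S⁻ ++ T    ≡⟨ regroup l⁺ l⁻ ⟨
  (S⁺ ++ l⁺) ++ (l⁻ ++ S⁻) ++ T  ∎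
  where
  open ≡-Reasoning
  S⁺ = S⁺→ (suc j) R
  S⁻ = S⁻← j R
  T = zetaTail j (R ++ h ∷ [])
  l⁺ = letter⁺ (suc j) h
  l⁻ = letter⁻ j h
  regroup : ∀ k l → (S⁺ ++ k) ++ (l ++ S⁻) ++ T ≡ S⁺ ++ (k ++ l) ++ S⁻ ++ T
  regroup k l rewrite ++-assoc S⁺ k ((l ++ S⁻) ++ T) | ++-assoc l S⁻ T | ++-assoc k l (S⁻ ++ T) = refl

-- The first scan S⁻ has no partner S⁺ before it. The bounds on h keep the last row silent there,
-- both at height h and at 1 - h.
zetaWord-reflect : ∀ M R h → - + M ℤ.< h → h ℤ.≤ + M →
  zetaWord M (R ++ reflect h ∷ []) ≡ zetaWord M (R ++ h ∷ [])
zetaWord-reflect M R h lo hi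
  rewrite zetaWord-tail M (R ++ reflect h ∷ []) | zetaWord-tail M (R ++ h ∷ [])
        | S⁻-snoc M R h | S⁻-snoc M R (reflect h) | letter⁻-reflect M h | zetaTail-reflect M R h
        | emit-[] {p = N} {E} {+ suc M} {+ suc (suc M)} {h} (λ { refl → 1+n≰n hi }) (λ { refl → 1+n≰n (ℤP.≤-trans (ℤ.+≤+ (ℕP.n≤1+n _)) hi) })
        | emit-[] {p = N} {E} {x = - + M} {y = - + suc M} {a = h} (λ { refl → ℤP.<-irrefl refl lo })
            (λ { refl → ℤP.<-asym lo (ℤP.neg-mono-< (ℤ.+<+ (ℕP.n<1+n M))) }) = refl

-- Forgetting the labels: from the labelled word to ζ_B.

map-proj₁-lscan : ∀ j X → map proj₁ (lscan j X) ≡ scan (+ j) (+ suc j) (map proj₂ X)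
map-proj₁-lscan j [] = refl
map-proj₁-lscan j ((y , h) ∷ X) =
  trans (map-++ proj₁ (emitRow j (y , h)) (lscan j X)) (cong₂ _++_ row (map-proj₁-lscan j X))
  where
  row : map proj₁ (emitRow j (y , h)) ≡ emit N E (+ j) (+ suc j) h
  row with h ℤ.≟ + j | h ℤ.≟ + suc j
  ... | yes _ | _ = refl
  ... | no _ | yes _ = refl
  ... | no _ | no _ = refl

scan-neg : ∀ x y a → scan x y (map -_ a) ≡ scan (- x) (- y) a
scan-neg x y [] = refl
scan-neg x y (h ∷ a) = cong₂ _++_ (emit-cong (- h) h (==-neg h x) (==-neg h y)) (scan-neg x y a)

lscan-ascending : ∀ j X → map proj₁ (lscan j (ascending X)) ≡ S⁺→ j (map proj₂ X)
lscan-ascending j X = trans (map-proj₁-lscan j (ascending X)) (cong (scan (+ j) (+ suc j)) (sym (map-∘ X)))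

lscan-descending : ∀ j X → map proj₁ (lscan j (descending X)) ≡ S⁻← j (map proj₂ X)
lscan-descending j X = begin
  map proj₁ (lscan j (descending X))                         ≡⟨ map-proj₁-lscan j (descending X) ⟩
  scan (+ j) (+ suc j) (map proj₂ (reverse (map negHeight X))) ≡⟨ cong (scan (+ j) (+ suc j)) heights ⟩
  scan (+ j) (+ suc j) (map -_ (reverse (map proj₂ X)))      ≡⟨ scan-neg (+ j) (+ suc j) (reverse (map proj₂ X)) ⟩
  S⁻← j (map proj₂ X)                                        ∎
  where
  open ≡-Reasoning
  heights : map proj₂ (reverse (map negHeight X)) ≡ map -_ (reverse (map proj₂ X))
  heights = begin
    map proj₂ (reverse (map negHeight X)) ≡⟨ reverse-map proj₂ (map negHeight X) ⟩
    reverse (map proj₂ (map negHeight X)) ≡⟨ cong reverse (map-∘ X) ⟨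
    reverse (map (-_ ∘ proj₂) X)          ≡⟨ cong reverse (map-∘ X) ⟩
    reverse (map -_ (map proj₂ X))        ≡⟨ reverse-map -_ (map proj₂ X) ⟨
    map -_ (reverse (map proj₂ X))        ∎

module _ (X : List Row) where
  open Path (ascending X) (descending X)

  -- Deleting the last letter of a concatenation acts on the second factor only if that factor is
  -- nonempty; the central N guarantees this.
  NonEmpty : List Letter → Set
  NonEmpty [] = ⊥
  NonEmpty (_ ∷ _) = ⊤

  nonEmpty-++ : ∀ K {L} → NonEmpty L → NonEmpty (K ++ L)
  nonEmpty-++ [] ne = ne
  nonEmpty-++ (_ ∷ _) ne = tt

  nonEmpty-body : ∀ j → NonEmpty (body j)
  nonEmpty-body zero = tt
  nonEmpty-body (suc j) =
    nonEmpty-++ (lscan (suc j) (ascending X)) (nonEmpty-++ (lscan j (descending X)) (nonEmpty-body j))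

  word-++ : ∀ K L → NonEmpty L → word (K ++ L) ≡ map proj₁ K ++ word L
  word-++ K L@(s ∷ L′) _ =
    trans (cong dropLast (map-++ proj₁ K L)) (dropLast-++ (map proj₁ K) (proj₁ s) (map proj₁ L′))

  word-body : ∀ j → word (body j) ≡ zetaTail j (map proj₂ X)
  word-path : ∀ j → word (path j) ≡ S⁻← j (map proj₂ X) ++ zetaTail j (map proj₂ X)
  word-body zero = cong (dropLast ∘ (N ∷_)) (lscan-ascending 0 X)
  word-body (suc j) =
    trans (word-++ (lscan (suc j) (ascending X)) (path j) (nonEmpty-++ (lscan j (descending X)) (nonEmpty-body j)))
      (cong₂ _++_ (lscan-ascending (suc j) X) (word-path j))
  word-path j = trans (word-++ (lscan j (descending X)) (body j) (nonEmpty-body j))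
    (cong₂ _++_ (lscan-descending j X) (word-body j))

  zetaWord≡word : ∀ j → zetaWord j (map proj₂ X) ≡ word (path j)
  zetaWord≡word j = trans (zetaWord-tail j (map proj₂ X)) (sym (word-path j))

-- Windows, and their invariance under reflection of the last height

-- The index i of the step of d_B at which a row of height h is written.
index : ℤ → ℕ
index (+ zero) = 0
index (+ suc i) = i
index -[1+ i ] = suc i

index-neg : ∀ i → index (- + i) ≡ i
index-neg zero = refl
index-neg (suc i) = refl

index-≤ : ∀ h → index h ≤ ∣ h ∣
index-≤ (+ zero) = z≤n
index-≤ (+ suc i) = ℕP.n≤1+n i
index-≤ -[1+ i ] = ℕP.≤-refl

index-reflect : ∀ h → index (reflect h) ≡ index h
index-reflect (+ zero) = refl
index-reflect (+ suc i) = trans (cong index (reflect-+suc i)) (index-neg i)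
index-reflect -[1+ i ] = refl

-- The entries contributed by step i of d_B.
block : List Row → ℕ → List ℤ
block X i = level (- + i) X ++ reverse (level (+ suc i) (ascending X))

window : List Row → ℕ → List ℤ
window X B = concatMap (block X) (upTo (suc B))

module _ (X : List Row) where
  open Path (ascending X) (descending X)

  reverse-block : ∀ i → reverse (block X i) ≡ level (+ suc i) (ascending X) ++ level (+ i) (descending X)
  reverse-block i = begin
    reverse (level (- + i) X ++ reverse U)           ≡⟨ reverse-++ (level (- + i) X) (reverse U) ⟩
    reverse (reverse U) ++ reverse (level (- + i) X) ≡⟨ cong₂ _++_ (reverse-involutive U) (sym (level-descending (+ i) X)) ⟩
    U ++ level (+ i) (descending X)                  ∎
    where
    open ≡-Reasoning
    U = level (+ suc i) (ascending X)

  window-suc : ∀ B → window X (suc B) ≡ window X B ++ block X (suc B)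
  window-suc B = begin
    concatMap (block X) (upTo (suc (suc B)))                 ≡⟨ cong (concatMap (block X)) (upTo-∷ʳ (suc B)) ⟨
    concatMap (block X) (upTo (suc B) ++ suc B ∷ [])         ≡⟨ concatMap-++ (block X) (upTo (suc B)) (suc B ∷ []) ⟩
    window X B ++ block X (suc B) ++ []                      ≡⟨ cong (window X B ++_) (++-identityʳ (block X (suc B))) ⟩
    window X B ++ block X (suc B)                            ∎
    where open ≡-Reasoning

  -- The link between d_B and ζ_B: backwards, the steps of d_B visit the rows in the order in which
  -- the scans do.
  reverse-window : ∀ B → reverse (window X B) ≡ levels B
  reverse-window zero = trans (cong reverse (++-identityʳ (block X 0))) (reverse-block 0)
  reverse-window (suc B) = begin
    reverse (window X (suc B))                      ≡⟨ cong reverse (window-suc B) ⟩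
    reverse (window X B ++ block X (suc B))         ≡⟨ reverse-++ (window X B) (block X (suc B)) ⟩
    reverse (block X (suc B)) ++ reverse (window X B) ≡⟨ cong₂ _++_ (reverse-block (suc B)) (reverse-window B) ⟩
    (U ++ D) ++ levels B                            ≡⟨ ++-assoc U D (levels B) ⟩
    levels (suc B)                                  ∎
    where
    open ≡-Reasoning
    U = level (+ suc (suc B)) (ascending X)
    D = level (+ suc B) (descending X)

  IndexedBy : ℕ → Set
  IndexedBy B = All (λ r → index (proj₂ r) ≤ B) X

  block-[] : ∀ {B} i → IndexedBy B → B < i → block X i ≡ []
  block-[] i covered B<i
    rewrite level-ascending (+ suc i) X
          | level-[] {+ suc i} (All.map (λ { {_ , h} le refl → ℕP.<⇒≱ B<i le }) covered)
          | level-[] {x = - + i} (All.map (λ { {_ , h} le refl → ℕP.<⇒≱ B<i (subst (_≤ _) (index-neg i) le) }) covered)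
          = refl

  window-≤′ : ∀ {B B′} → IndexedBy B → B ℕ.≤′ B′ → window X B′ ≡ window X B
  window-≤′ covered ℕ.≤′-refl = refl
  window-≤′ covered (ℕ.≤′-step {B′} le) = trans (window-suc B′)
    (trans (cong₂ _++_ (window-≤′ covered le) (block-[] (suc B′) covered (s≤s (ℕP.≤′⇒≤ le)))) (++-identityʳ _))

  -- Allows the bound Σ|μ_j| of d_B to be replaced by the bound 2n of ζ_B: blocks beyond the largest
  -- index are empty.
  window-unique : ∀ {B B′} → IndexedBy B → IndexedBy B′ → window X B ≡ window X B′
  window-unique {B} {B′} cov cov′ with ℕP.≤-total B B′
  ... | inj₁ le = sym (window-≤′ cov (ℕP.≤⇒≤′ le))
  ... | inj₂ ge = window-≤′ cov′ (ℕP.≤⇒≤′ ge)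

-- The length of a window.

length-block : ∀ X i → length (block X i) ≡ length (level (- + i) X) ℕ.+ length (level (+ suc i) X)
length-block X i = trans (length-++ (level (- + i) X)) (cong (length (level (- + i) X) ℕ.+_)
  (trans (length-reverse (level (+ suc i) (ascending X)))
    (trans (cong length (level-ascending (+ suc i) X)) (length-map -_ (level (+ suc i) X)))))

+-interchange : ∀ a b c d → (a ℕ.+ b) ℕ.+ (c ℕ.+ d) ≡ (a ℕ.+ c) ℕ.+ (b ℕ.+ d)
+-interchange = ℕSolver.solve-∀

length-block-∷ : ∀ r X i → length (block (r ∷ X) i) ≡ length (block (r ∷ []) i) ℕ.+ length (block X i)
length-block-∷ r X i
  rewrite length-block (r ∷ X) i | length-block (r ∷ []) i | length-block X i
        | level-++ (- + i) (r ∷ []) X | level-++ (+ suc i) (r ∷ []) X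
        | length-++ (level (- + i) (r ∷ [])) {level (- + i) X}
        | length-++ (level (+ suc i) (r ∷ [])) {level (+ suc i) X} =
  +-interchange (length (level (- + i) (r ∷ []))) (length (level (- + i) X)) _ _

length-window-∷ : ∀ r X B → length (window (r ∷ X) B) ≡ length (window (r ∷ []) B) ℕ.+ length (window X B)
length-window-∷ r X B = go (upTo (suc B))
  where
  go : ∀ is → length (concatMap (block (r ∷ X)) is) ≡
    length (concatMap (block (r ∷ [])) is) ℕ.+ length (concatMap (block X) is)
  go [] = refl
  go (i ∷ is) rewrite length-++ (block (r ∷ X) i) {concatMap (block (r ∷ X)) is}
    | length-++ (block (r ∷ []) i) {concatMap (block (r ∷ [])) is}
    | length-++ (block X i) {concatMap (block X) is} | length-block-∷ r X i | go is =
    +-interchange (length (block (r ∷ []) i)) (length (block X i)) _ _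

level-hit : ∀ {x y h} → h ≡ x → level x ((y , h) ∷ []) ≡ y ∷ []
level-hit {x} {y} {h} eq with h ℤ.≟ x
... | yes _ = refl
... | no ne = ⊥-elim (ne eq)

length-block-index : ∀ y h → length (block ((y , h) ∷ []) (index h)) ≡ 1
length-block-index y (+ zero) = refl
length-block-index y (+ suc i)
  rewrite level-[] {x = - (+ i)} {X = (y , + suc i) ∷ []} (≰0⇒≢neg i (λ { (ℤ.+≤+ ()) }) ∷ [])
        | level-hit {+ suc i} {y = - y} refl = refl
length-block-index y -[1+ i ] rewrite level-hit { -[1+ i ]} {y} refl = refl

block-other : ∀ y h i → index h ≢ i → block ((y , h) ∷ []) i ≡ []
block-other y h i ne
  rewrite level-ascending (+ suc i) ((y , h) ∷ [])
        | level-[] {+ suc i} {(y , h) ∷ []} ((λ { refl → ne refl }) ∷ [])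
        | level-[] {x = - + i} {X = (y , h) ∷ []} ((λ { refl → ne (index-neg i) }) ∷ []) = refl

-- A single row enters at the block numbered by its index. The count 0 before that block is carried
-- along for the induction on B.
length-window-single : ∀ y h B → (index h ≤ B → length (window ((y , h) ∷ []) B) ≡ 1) ×
  (B < index h → length (window ((y , h) ∷ []) B) ≡ 0)
length-window-single y h zero = le , gt
  where
  le : index h ≤ 0 → length (window ((y , h) ∷ []) 0) ≡ 1
  le z = trans (cong length (++-identityʳ (block ((y , h) ∷ []) 0)))
    (subst (λ i → length (block ((y , h) ∷ []) i) ≡ 1) (ℕP.n≤0⇒n≡0 z) (length-block-index y h))
  gt : 0 < index h → length (window ((y , h) ∷ []) 0) ≡ 0
  gt p = cong length (trans (++-identityʳ (block ((y , h) ∷ []) 0)) (block-other y h 0 (ℕP.>⇒≢ p)))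
length-window-single y h (suc B) rewrite window-suc ((y , h) ∷ []) B
  | length-++ (window ((y , h) ∷ []) B) {block ((y , h) ∷ []) (suc B)}
  with length-window-single y h B
... | le , gt = le′ , gt′
  where
  le′ : index h ≤ suc B → length (window ((y , h) ∷ []) B) ℕ.+ length (block ((y , h) ∷ []) (suc B)) ≡ 1
  le′ p with ℕP.m≤n⇒m<n∨m≡n p
  ... | inj₁ (s≤s q) rewrite le q | block-other y h (suc B) (λ eq → ℕP.<-irrefl eq (s≤s q)) = refl
  ... | inj₂ eq = trans (cong (ℕ._+ length (block ((y , h) ∷ []) (suc B))) (gt (ℕP.≤-reflexive (sym eq))))
    (subst (λ i → length (block ((y , h) ∷ []) i) ≡ 1) eq (length-block-index y h))
  gt′ : suc B < index h → length (window ((y , h) ∷ []) B) ℕ.+ length (block ((y , h) ∷ []) (suc B)) ≡ 0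
  gt′ p rewrite gt (ℕP.<-trans (ℕP.n<1+n B) p) | block-other y h (suc B) (ℕP.>⇒≢ p) = refl

-- Lengths of windows are additive in the rows, and each covered row contributes exactly one entry.
length-window : ∀ {B} X → IndexedBy X B → length (window X B) ≡ length X
length-window {B} [] [] = go (upTo (suc B))
  where
  go : ∀ is → length (concatMap (block []) is) ≡ 0
  go [] = refl
  go (i ∷ is) = go is
length-window {B} (r@(y , h) ∷ X) (le ∷ les) = trans (length-window-∷ r X B)
  (cong₂ ℕ._+_ (proj₁ (length-window-single y h B) le) (length-window X les))

-- The last row stands in the middle of a block: it ends the forward half and begins the reversed
-- half.
block-snoc : ∀ X y h i → block (X ++ (y , h) ∷ []) i ≡
  level (- + i) X ++ block ((y , h) ∷ []) i ++ reverse (level (+ suc i) (ascending X))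
block-snoc X y h i
  rewrite map-++ negLabel X ((y , h) ∷ []) | level-++ (- + i) X ((y , h) ∷ [])
        | level-++ (+ suc i) (ascending X) ((- y , h) ∷ [])
        | reverse-++ (level (+ suc i) (ascending X)) (level (+ suc i) ((- y , h) ∷ []))
        | ++-assoc (level (- + i) X) (level (- + i) ((y , h) ∷ [])) (reverse (level (+ suc i) ((- y , h) ∷ [])) ++ reverse (level (+ suc i) (ascending X)))
        | ++-assoc (level (- + i) ((y , h) ∷ [])) (reverse (level (+ suc i) ((- y , h) ∷ []))) (reverse (level (+ suc i) (ascending X))) = refl

-- Reflection exchanges the heights -i and i + 1, hence the two halves of the block. The sign change
-- of the label compensates the negation in the second half.
block-reflect : ∀ y h i → block ((- y , reflect h) ∷ []) i ≡ block ((y , h) ∷ []) i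
block-reflect y h i
  rewrite trans (==-reflect h (- + i)) (==-cong h (reflect-neg i))
        | trans (==-reflect h (+ suc i)) (==-cong h (reflect-+suc i)) | ℤP.neg-involutive y
  with h ℤ.≟ + suc i | h ℤ.≟ - + i
... | yes p | yes q = ⊥-elim (≰0⇒≢neg i (λ { (ℤ.+≤+ ()) }) (trans (sym p) q))
... | yes _ | no _ = refl
... | no _ | yes _ = refl
... | no _ | no _ = refl

window-reflect : ∀ X y h B → window (X ++ (- y , reflect h) ∷ []) B ≡ window (X ++ (y , h) ∷ []) B
window-reflect X y h B = concatMap-cong (λ i → begin
  block (X ++ (- y , reflect h) ∷ []) i ≡⟨ block-snoc X (- y) (reflect h) i ⟩
  level (- + i) X ++ block ((- y , reflect h) ∷ []) i ++ reverse (level (+ suc i) (ascending X))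
    ≡⟨ cong (λ b → level (- + i) X ++ b ++ reverse (level (+ suc i) (ascending X))) (block-reflect y h i) ⟩
  level (- + i) X ++ block ((y , h) ∷ []) i ++ reverse (level (+ suc i) (ascending X))
    ≡⟨ block-snoc X y h i ⟨
  block (X ++ (y , h) ∷ []) i           ∎) (upTo (suc B))
  where open ≡-Reasoning

≡ᵇ-refl : ∀ n → (n ≡ᵇ n) ≡ true
≡ᵇ-refl zero = refl
≡ᵇ-refl (suc n) = ≡ᵇ-refl n

<⇒≡ᵇ-false : ∀ {k n} → k < n → (k ≡ᵇ n) ≡ false
<⇒≡ᵇ-false {zero} (s≤s _) = refl
<⇒≡ᵇ-false {suc k} (s≤s k<n) = <⇒≡ᵇ-false k<n

applyUpTo-cong : ∀ {A : Set} {f g : ℕ → A} n → (∀ k → k < n → f k ≡ g k) → applyUpTo f n ≡ applyUpTo g n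
applyUpTo-cong zero eq = refl
applyUpTo-cong (suc n) eq = cong₂ _∷_ (eq 0 (s≤s z≤n)) (applyUpTo-cong n (λ k k< → eq (suc k) (s≤s k<)))

-- d_B as a window

signed : Bool → ℕ → ℕ × ℤ → ℤ
signed b n r = if (proj₁ r ≡ᵇ n) ∧ b then - proj₂ r else proj₂ r

signed-neg : ∀ b n k y → signed b n (k , - y) ≡ - signed b n (k , y)
signed-neg b n k y with (k ≡ᵇ n) ∧ b
... | true = refl
... | false = refl

flipped : ℕ → List Step → Bool
flipped n π = isEven ∣ muAt n π (n ℕ.∸ 1) ℤ.+ muAt n π n ∣

-- The function mapped over dTagged in dB is local to Defs, so it is recovered by unification.
dB-map : ∀ n π v → ∃[ f ] dB n π v ≡ map f (dTagged n π v)
dB-map n π v = _ , refl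

dB-signed : ∀ n π v → dB n π v ≡ map (signed (flipped n π) n) (dTagged n π v)
dB-signed n π v = map-cong pointwise (dTagged n π v)
  where
  pointwise : ∀ r → proj₁ (dB-map n π v) r ≡ signed (flipped n π) n r
  pointwise (k , y) with k ≡ᵇ n
  ... | true = refl
  ... | false = refl

map-filter-level : ∀ {A : Set} (g h : A → ℤ) x R →
  map g (filter (λ r → h r ℤ.≟ x) R) ≡ level x (map (λ r → g r , h r) R)
map-filter-level g h x [] = refl
map-filter-level g h x (r ∷ R) with h r ℤ.≟ x
... | yes _ = cong (g r ∷_) (map-filter-level g h x R)
... | no _ = map-filter-level g h x R

-- The sign change of d_B is put into the label of row n at once; by `signed-neg` it commutes with
-- the negation in the second half of a step.
muRow : ℕ → List Step → List ℤ → ℕ → Row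
muRow n π v k = signed (flipped n π) n (suc k , at v (suc k)) , muAt n π (suc k)

dB-window : ∀ n π v → dB n π v ≡ window (applyUpTo (muRow n π v) n) (dBound n π)
dB-window n π v = begin
  dB n π v                                               ≡⟨ dB-signed n π v ⟩
  map s (concatMap (dStep n π v) is)                     ≡⟨ map-concatMap s (dStep n π v) is ⟩
  concatMap (map s ∘ dStep n π v) is                     ≡⟨ concatMap-cong step is ⟩
  window (map toRow (rowsMu n π)) (dBound n π)           ≡⟨ cong (λ X → window X (dBound n π)) rows≡ ⟩
  window (applyUpTo (muRow n π v) n) (dBound n π)        ∎
  where
  open ≡-Reasoning
  s = signed (flipped n π) n
  is = upTo (suc (dBound n π))
  label : ℕ × ℤ → ℤ
  label r = s (proj₁ r , at v (proj₁ r))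
  toRow : ℕ × ℤ → Row
  toRow r = label r , proj₂ r
  rows≡ : map toRow (rowsMu n π) ≡ applyUpTo (muRow n π v) n
  rows≡ = trans (sym (map-∘ (upTo n))) (map-upTo (muRow n π v) n)
  neg : ℕ × ℤ → ℤ
  neg r = s (proj₁ r , - at v (proj₁ r))
  step : ∀ i → map s (dStep n π v i) ≡ block (map toRow (rowsMu n π)) i
  step i = begin
    map s (map _ F ++ map _ (reverse F′))         ≡⟨ map-++ s (map _ F) _ ⟩
    map s (map _ F) ++ map s (map _ (reverse F′)) ≡⟨ cong₂ _++_ (map-∘ F) (map-∘ (reverse F′)) ⟨
    map label F ++ map neg (reverse F′)           ≡⟨ cong₂ _++_ (map-filter-level label proj₂ (- + i) (rowsMu n π)) (reverse-map neg F′) ⟩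
    level (- + i) (map toRow (rowsMu n π)) ++ reverse (map neg F′)
      ≡⟨ cong (λ l → level (- + i) (map toRow (rowsMu n π)) ++ reverse l) negs ⟩
    block (map toRow (rowsMu n π)) i              ∎
    where
    F = filter (λ r → proj₂ r ℤ.≟ - + i) (rowsMu n π)
    F′ = filter (λ r → proj₂ r ℤ.≟ + suc i) (rowsMu n π)
    negs : map neg F′ ≡ level (+ suc i) (ascending (map toRow (rowsMu n π)))
    negs = begin
      map neg F′                                              ≡⟨ map-filter-level neg proj₂ (+ suc i) (rowsMu n π) ⟩
      level (+ suc i) (map (λ r → neg r , proj₂ r) (rowsMu n π))
        ≡⟨ cong (level (+ suc i)) (map-cong (λ r → cong (_, proj₂ r) (signed-neg (flipped n π) n (proj₁ r) (at v (proj₁ r)))) (rowsMu n π)) ⟩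
      level (+ suc i) (map (negLabel ∘ toRow) (rowsMu n π))   ≡⟨ cong (level (+ suc i)) (map-∘ (rowsMu n π)) ⟩
      level (+ suc i) (ascending (map toRow (rowsMu n π)))    ∎

All-≤-sum : ∀ ns → All (_≤ sum ns) ns
All-≤-sum [] = []
All-≤-sum (k ∷ ns) = ℕP.m≤m+n k (sum ns) ∷ All.map (λ le → ℕP.≤-trans le (ℕP.m≤n+m (sum ns) k)) (All-≤-sum ns)

indexed-dBound : ∀ n π v → IndexedBy (applyUpTo (muRow n π v) n) (dBound n π)
indexed-dBound n π v = AllP.applyUpTo⁺₁ (muRow n π v) n λ {k} k< →
  ℕP.≤-trans (index-≤ (muAt n π (suc k)))
    (AllP.applyUpTo⁻ (λ k → ∣ muAt n π (suc k) ∣) n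
      (subst (All (_≤ dBound n π)) abs≡ (All-≤-sum (map ∣_∣ (mu n π)))) k<)
  where
  abs≡ : map ∣_∣ (mu n π) ≡ applyUpTo (λ k → ∣ muAt n π (suc k) ∣) n
  abs≡ = trans (cong (map ∣_∣) (map-upTo (λ k → muAt n π (suc k)) n)) (map-applyUpTo _ ∣_∣ n)

-- The sequence π_i

-- eastFrom e π k is e plus the number of East steps before the North step number k, counted from 0.
eastFrom : ℕ → List Step → ℕ → ℕ
eastFrom e [] k = 0
eastFrom e (N ∷ π) zero = e
eastFrom e (N ∷ π) (suc k) = eastFrom e π k
eastFrom e (E ∷ π) k = eastFrom (suc e) π k

nth-piSeq : ∀ e π k → nth (map +_ (piSeqFrom e π)) k ≡ + eastFrom e π k
nth-piSeq e [] k = refl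
nth-piSeq e (N ∷ π) zero = refl
nth-piSeq e (N ∷ π) (suc k) = nth-piSeq e π k
nth-piSeq e (E ∷ π) k = nth-piSeq (suc e) π k

eastFrom-≥ : ∀ e π k → k < countN π → e ≤ eastFrom e π k
eastFrom-≥ e (N ∷ π) zero _ = ℕP.≤-refl
eastFrom-≥ e (N ∷ π) (suc k) (s≤s k<) = eastFrom-≥ e π k k<
eastFrom-≥ e (E ∷ π) k k< = ℕP.≤-trans (ℕP.n≤1+n e) (eastFrom-≥ (suc e) π k k<)

eastFrom-≤ : ∀ e π k → eastFrom e π k ≤ e ℕ.+ countE π
eastFrom-≤ e [] k = z≤n
eastFrom-≤ e (N ∷ π) zero = ℕP.m≤m+n e (countE π)
eastFrom-≤ e (N ∷ π) (suc k) = eastFrom-≤ e π k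
eastFrom-≤ e (E ∷ π) k = subst (eastFrom (suc e) π k ≤_) (sym (ℕP.+-suc e (countE π))) (eastFrom-≤ (suc e) π k)

eastFrom-mono : ∀ e π k → suc k < countN π → eastFrom e π k ≤ eastFrom e π (suc k)
eastFrom-mono e (N ∷ π) zero (s≤s k<) = eastFrom-≥ e π 0 k<
eastFrom-mono e (N ∷ π) (suc k) (s≤s k<) = eastFrom-mono e π k k<
eastFrom-mono e (E ∷ π) k k< = eastFrom-mono (suc e) π k k<

-- Here j is the number of N's already read and k counts the remaining ones from 0. Two successive
-- N's form a rise exactly if no E between them increases the count.
RiseFrom : ℕ → ℕ → List Step → ℕ → Set
RiseFrom e j π i = ∃[ k ] i ≡ suc (j ℕ.+ k) × suc k < countN π × eastFrom e π k ≡ eastFrom e π (suc k)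

RiseFrom-N : ∀ {e j π i} → RiseFrom e (suc j) π i → RiseFrom e j (N ∷ π) i
RiseFrom-N {j = j} (k , refl , k< , eq) = suc k , cong suc (sym (ℕP.+-suc j k)) , s≤s k< , eq

rises⇒ : ∀ e j π {i} → i ∈ risesFrom j π → RiseFrom e j π i
rises⇒ e j (N ∷ N ∷ π) (here refl) = 0 , cong suc (sym (ℕP.+-identityʳ j)) , s≤s (s≤s z≤n) , refl
rises⇒ e j (N ∷ N ∷ π) (there m) = RiseFrom-N (rises⇒ e (suc j) (N ∷ π) m)
rises⇒ e j (N ∷ E ∷ π) m = RiseFrom-N {π = E ∷ π} (rises⇒ e (suc j) (E ∷ π) m)
rises⇒ e j (E ∷ π) m = rises⇒ (suc e) j π m

rises⇐ : ∀ e j π k → suc k < countN π → eastFrom e π k ≡ eastFrom e π (suc k) →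
  suc (j ℕ.+ k) ∈ risesFrom j π
rises⇐ e j (N ∷ []) k (s≤s ()) eq
rises⇐ e j (N ∷ N ∷ π) zero k< eq = here (cong suc (ℕP.+-identityʳ j))
rises⇐ e j (N ∷ N ∷ π) (suc k) (s≤s k<) eq rewrite ℕP.+-suc j k = there (rises⇐ e (suc j) (N ∷ π) k k< eq)
rises⇐ e j (N ∷ E ∷ π) zero (s≤s k<) eq = ⊥-elim (ℕP.<⇒≢ (eastFrom-≥ (suc e) π 0 k<) eq)
rises⇐ e j (N ∷ E ∷ π) (suc k) (s≤s k<) eq rewrite ℕP.+-suc j k = rises⇐ (suc e) (suc j) π k k< eq
rises⇐ e j (E ∷ π) k k< eq = rises⇐ (suc e) j π k k< eq

starts⇒ : ∀ {π} → StartsWithN π → eastFrom 0 π 0 ≡ 0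
starts⇒ (startsN _) = refl

starts⇐ : ∀ π → 0 < countN π → eastFrom 0 π 0 ≡ 0 → StartsWithN π
starts⇐ (N ∷ π) _ _ = startsN π
starts⇐ (E ∷ π) k< eq = ⊥-elim (ℕP.<⇒≢ (eastFrom-≥ 1 π 0 k<) (sym eq))

-- Heights of a lattice path

isEven-2* : ∀ k → isEven (2 ℕ.* k) ≡ true
isEven-2* zero = refl
isEven-2* (suc k) rewrite ℕP.+-suc k (k ℕ.+ 0) = isEven-2* k

isEven-suc-2* : ∀ k → isEven (suc (2 ℕ.* k)) ≡ false
isEven-suc-2* zero = refl
isEven-suc-2* (suc k) rewrite ℕP.+-suc k (k ℕ.+ 0) = isEven-suc-2* k

isEven-∣2*∣ : ∀ z → isEven ∣ + 2 ℤ.* z ∣ ≡ true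
isEven-∣2*∣ z = trans (cong isEven (ℤP.abs-* (+ 2) z)) (isEven-2* ∣ z ∣)

isEven-∣1+2*∣ : ∀ z → isEven ∣ + 1 ℤ.+ + 2 ℤ.* z ∣ ≡ false
isEven-∣1+2*∣ (+ k) = trans (cong (λ z → isEven ∣ + 1 ℤ.+ z ∣) (sym (ℤP.pos-* 2 k))) (isEven-suc-2* k)
isEven-∣1+2*∣ -[1+ k ] = trans (cong (isEven ∘ ∣_∣) (ring (+ k)))
  (trans (cong isEven (ℤP.∣-i∣≡∣i∣ (+ 1 ℤ.+ + 2 ℤ.* + k))) (isEven-∣1+2*∣ (+ k)))
  where
  ring : ∀ k → + 1 ℤ.+ + 2 ℤ.* (- (+ 1 ℤ.+ k)) ≡ - (+ 1 ℤ.+ + 2 ℤ.* k)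
  ring = solve-∀

module Heights (m : ℕ) (π : List Step) (inL : InL (suc (suc m)) π) where

  private
    n : ℕ
    n = suc (suc m)

  p : ℕ → ℕ
  p = eastFrom 0 π

  piAt≡p : ∀ k → piAt π (suc k) ≡ + p k
  piAt≡p = nth-piSeq 0 π

  p≤n : ∀ k → p k ≤ n
  p≤n k = subst (p k ≤_) (proj₂ inL) (eastFrom-≤ 0 π k)

  p-mono : ∀ k → suc k < n → p k ≤ p (suc k)
  p-mono k k< = eastFrom-mono 0 π k (subst (suc k <_) (sym (proj₁ inL)) k<)

  x : ℤ
  x = + 2 ℤ.* + p (suc m) ℤ.- + p m ℤ.- + n

  c : ℕ → ℤ
  c k = if k ≡ᵇ suc m then x else + p k ℤ.- + suc k

  c-inner : ∀ {k} → k < suc m → c k ≡ + p k ℤ.- + suc k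
  c-inner k< rewrite <⇒≡ᵇ-false k< = refl

  c-last : c (suc m) ≡ x
  c-last rewrite ≡ᵇ-refl m = refl

  muAt-inner : ∀ {k} → k < suc m → muAt n π (suc k) ≡ c k
  muAt-inner {k} k< rewrite <⇒≡ᵇ-false k< = cong (ℤ._- + suc k) (piAt≡p k)

  -- Two binary choices enter: the residue of n modulo 4 and the parity of π_1 + ... + π_{n-2}. Each
  -- nonstandard choice replaces x by 1 - x, and two of them cancel.
  muAt-last : muAt n π n ≡ x ⊎ muAt n π n ≡ reflect x
  muAt-last rewrite ≡ᵇ-refl m | piAt≡p (suc m) | piAt≡p m
    with ((n % 4) ≡ᵇ 0) ∨ ((n % 4) ≡ᵇ 3) | isEven (sum (take m (piSeq π)))
  ... | true | true = inj₁ refl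
  ... | false | true = inj₂ (ring (+ p (suc m)) (+ p m) (+ n))
    where
    ring : ∀ a b n → + 1 ℤ.+ n ℤ.- (+ 2 ℤ.* a ℤ.- b) ≡ + 1 ℤ.- (+ 2 ℤ.* a ℤ.- b ℤ.- n)
    ring = solve-∀
  ... | true | false = inj₂ (trans (cong (λ z → z ℤ.- + 2 ℤ.* + p (suc m) ℤ.+ + p m ℤ.- + n) 2n+1)
      (ring (+ p (suc m)) (+ p m) (+ n)))
    where
    2n+1 : + (2 ℕ.* n ℕ.+ 1) ≡ + 2 ℤ.* + n ℤ.+ + 1
    2n+1 = trans (ℤP.pos-+ (2 ℕ.* n) 1) (cong (ℤ._+ + 1) (ℤP.pos-* 2 n))
    ring : ∀ a b n → + 2 ℤ.* n ℤ.+ + 1 ℤ.- + 2 ℤ.* a ℤ.+ b ℤ.- n ≡ + 1 ℤ.- (+ 2 ℤ.* a ℤ.- b ℤ.- n)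
    ring = solve-∀
  ... | false | false = inj₁ (trans (cong (λ z → + suc n ℤ.- (z ℤ.- + 2 ℤ.* + p (suc m) ℤ.+ + p m)) 2n+1)
      (ring (+ p (suc m)) (+ p m) (+ n)))
    where
    2n+1 : + (2 ℕ.* n ℕ.+ 1) ≡ + 2 ℤ.* + n ℤ.+ + 1
    2n+1 = trans (ℤP.pos-+ (2 ℕ.* n) 1) (cong (ℤ._+ + 1) (ℤP.pos-* 2 n))
    ring : ∀ a b n → + 1 ℤ.+ n ℤ.- (+ 2 ℤ.* n ℤ.+ + 1 ℤ.- + 2 ℤ.* a ℤ.+ b) ≡ + 2 ℤ.* a ℤ.- b ℤ.- n
    ring = solve-∀

  muAt-penultimate : muAt n π (suc m) ≡ + p m ℤ.- + suc m
  muAt-penultimate = trans (muAt-inner (ℕP.n<1+n m)) (c-inner (ℕP.n<1+n m))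

  -- The sum μ_{n-1} + x equals 2(π_n - n) + 1, because π_{n-1} cancels; so it is odd.
  flipped-x : muAt n π n ≡ x → flipped n π ≡ false
  flipped-x eq = trans (cong (isEven ∘ ∣_∣) (trans (cong₂ ℤ._+_ muAt-penultimate eq) (ring (+ p (suc m)) (+ p m) (+ m))))
    (isEven-∣1+2*∣ (+ p (suc m) ℤ.- + m ℤ.- + 2))
    where
    ring : ∀ a b m → b ℤ.- (+ 1 ℤ.+ m) ℤ.+ (+ 2 ℤ.* a ℤ.- b ℤ.- (+ 1 ℤ.+ (+ 1 ℤ.+ m))) ≡ + 1 ℤ.+ + 2 ℤ.* (a ℤ.- m ℤ.- + 2)
    ring = solve-∀

  -- With 1 - x the sum becomes 2(π_{n-1} - π_n + 1), which is even.
  flipped-reflect : muAt n π n ≡ reflect x → flipped n π ≡ true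
  flipped-reflect eq = trans (cong (isEven ∘ ∣_∣) (trans (cong₂ ℤ._+_ muAt-penultimate eq) (ring (+ p (suc m)) (+ p m) (+ m))))
    (isEven-∣2*∣ (+ p m ℤ.- + p (suc m) ℤ.+ + 1))
    where
    ring : ∀ a b m → b ℤ.- (+ 1 ℤ.+ m) ℤ.+ (+ 1 ℤ.- (+ 2 ℤ.* a ℤ.- b ℤ.- (+ 1 ℤ.+ (+ 1 ℤ.+ m)))) ≡ + 2 ℤ.* (b ℤ.- a ℤ.+ + 1)
    ring = solve-∀

  inner-or-last : ∀ k → suc k < n → k < m ⊎ k ≡ m
  inner-or-last k (s≤s k<) with ℕP.m≤n⇒m<n∨m≡n k<
  ... | inj₁ (s≤s lt) = inj₁ lt
  ... | inj₂ refl = inj₂ refl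

  ≤⇒0≤ : ∀ {a b} → a ≤ b → + 0 ℤ.≤ + b ℤ.- + a
  ≤⇒0≤ = ℤP.i≤j⇒0≤j-i ∘ ℤ.+≤+

  step-inner : ∀ a b k → (+ 1 ℤ.+ (b ℤ.- (+ 1 ℤ.+ (+ 1 ℤ.+ k)))) ℤ.- (a ℤ.- (+ 1 ℤ.+ k)) ≡ b ℤ.- a
  step-inner = solve-∀

  step-last : ∀ a b m → (+ 1 ℤ.+ (+ 2 ℤ.* b ℤ.- a ℤ.- (+ 1 ℤ.+ (+ 1 ℤ.+ m)))) ℤ.- (a ℤ.- (+ 1 ℤ.+ m)) ≡ + 2 ℤ.* (b ℤ.- a)
  step-last = solve-∀

  -- The multiplier is 1, except for the last step, where it is 2.
  gap : ∀ k → suc k < n → ∃[ a ] (+ 1 ℤ.+ c (suc k)) ℤ.- c k ≡ + suc a ℤ.* (+ p (suc k) ℤ.- + p k)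
  gap k k< with inner-or-last k k<
  ... | inj₁ k<m = 0 , trans (cong₂ (λ s t → + 1 ℤ.+ s ℤ.- t) (c-inner (s≤s k<m)) (c-inner (ℕP.m≤n⇒m≤1+n k<m)))
    (trans (step-inner (+ p k) (+ p (suc k)) (+ k)) (sym (ℤP.*-identityˡ _)))
  ... | inj₂ refl = 1 , trans (cong₂ (λ s t → + 1 ℤ.+ s ℤ.- t) c-last (c-inner (ℕP.n<1+n m)))
    (step-last (+ p m) (+ p (suc m)) (+ m))

  c-step : ∀ k → suc k < n → c k ℤ.≤ + 1 ℤ.+ c (suc k)
  c-step k k< with a , eq ← gap k k< =
    ℤP.0≤i-j⇒j≤i (subst (+ 0 ℤ.≤_) (sym eq)
      (subst (ℤ._≤ + suc a ℤ.* (+ p (suc k) ℤ.- + p k)) (ℤP.*-zeroʳ (+ suc a))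
        (ℤP.*-monoˡ-≤-nonNeg (+ suc a) (≤⇒0≤ (p-mono k k<)))))

  rise⇒drop : ∀ k → suc k < n → p k ≡ p (suc k) → c k ≡ + 1 ℤ.+ c (suc k)
  rise⇒drop k k< pk with a , eq ← gap k k< =
    sym (ℤP.i-j≡0⇒i≡j _ _ (trans eq (trans (cong (+ suc a ℤ.*_) (ℤP.i≡j⇒i-j≡0 (cong +_ (sym pk)))) (ℤP.*-zeroʳ (+ suc a)))))

  drop⇒rise : ∀ k → suc k < n → c k ≡ + 1 ℤ.+ c (suc k) → p k ≡ p (suc k)
  drop⇒rise k k< ck with a , eq ← gap k k< =
    sym (ℤP.+-injective (ℤP.i-j≡0⇒i≡j _ _ (ℤP.*-cancelˡ-≡ (+ suc a) _ (+ 0)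
      (trans (sym eq) (trans (ℤP.i≡j⇒i-j≡0 (sym ck)) (sym (ℤP.*-zeroʳ (+ suc a))))))))

  c-first : c 0 ≡ + p 0 ℤ.- + 1
  c-first = c-inner (s≤s z≤n)

  -1≤c : - + 1 ℤ.≤ c 0
  -1≤c rewrite c-first = ≤-by {+ 0} (ℤ.+≤+ (z≤n {p 0})) (ring (+ p 0))
    where
    ring : ∀ a → (a ℤ.- + 1) ℤ.- - + 1 ≡ a ℤ.- + 0
    ring = solve-∀

  -- This amounts to π_n ≤ n, since c_{n-1} + c_n = 2π_n - 2n + 1.
  last-bound : c (suc m) ℤ.≤ + 1 ℤ.- c m
  last-bound rewrite c-last | c-inner (ℕP.n<1+n m) =
    ≤-by (ℤP.+-mono-≤ (ℤ.+≤+ (p≤n (suc m))) (ℤ.+≤+ (p≤n (suc m)))) (ring (+ p (suc m)) (+ p m) (+ m))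
    where
    ring : ∀ a b m → (+ 1 ℤ.- (b ℤ.- (+ 1 ℤ.+ m))) ℤ.- (+ 2 ℤ.* a ℤ.- b ℤ.- (+ 1 ℤ.+ (+ 1 ℤ.+ m)))
      ≡ ((+ 1 ℤ.+ (+ 1 ℤ.+ m)) ℤ.+ (+ 1 ℤ.+ (+ 1 ℤ.+ m))) ℤ.- (a ℤ.+ a)
    ring = solve-∀

  -n≤c : ∀ k → k < n → - + n ℤ.≤ c k
  -n≤c k (s≤s k≤) with ℕP.m≤n⇒m<n∨m≡n k≤
  ... | inj₁ k< rewrite c-inner k< =
    ≤-by (ℤP.+-mono-≤ (ℤ.+≤+ (ℕP.≤-trans k< (ℕP.n≤1+n (suc m)))) (ℤ.+≤+ (z≤n {p k}))) (ring (+ p k) (+ suc k) (+ n))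
    where
    ring : ∀ a k n → (a ℤ.- k) ℤ.- - n ≡ (n ℤ.+ a) ℤ.- (k ℤ.+ + 0)
    ring = solve-∀
  -- Here x + n = π_n + (π_n - π_{n-1}), and both summands are nonnegative.
  ... | inj₂ refl rewrite c-last =
    ≤-by (ℤP.+-mono-≤ (ℤ.+≤+ (p-mono m ℕP.≤-refl)) (ℤ.+≤+ (z≤n {p (suc m)}))) (ring (+ p (suc m)) (+ p m) (+ n))
    where
    ring : ∀ a b n → (+ 2 ℤ.* a ℤ.- b ℤ.- n) ℤ.- - n ≡ (a ℤ.+ a) ℤ.- (b ℤ.+ + 0)
    ring = solve-∀

  c≤n : ∀ k → k < n → c k ℤ.≤ + n
  c≤n k (s≤s k≤) with ℕP.m≤n⇒m<n∨m≡n k≤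
  ... | inj₁ k< rewrite c-inner k< =
    ≤-by (ℤP.+-mono-≤ (ℤ.+≤+ (p≤n k)) (ℤ.+≤+ (z≤n {suc k}))) (ring (+ p k) (+ suc k) (+ n))
    where
    ring : ∀ a k n → n ℤ.- (a ℤ.- k) ≡ (n ℤ.+ k) ℤ.- (a ℤ.+ + 0)
    ring = solve-∀
  ... | inj₂ refl rewrite c-last =
    ≤-by (ℤP.+-mono-≤ (ℤP.+-mono-≤ (ℤ.+≤+ (p≤n (suc m))) (ℤ.+≤+ (p≤n (suc m)))) (ℤ.+≤+ (z≤n {p m}))) (ring (+ p (suc m)) (+ p m) (+ n))
    where
    ring : ∀ a b n → n ℤ.- (+ 2 ℤ.* a ℤ.- b ℤ.- n) ≡ (n ℤ.+ n ℤ.+ b) ℤ.- (a ℤ.+ a ℤ.+ + 0)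
    ring = solve-∀

  rise⇔ : ∀ k → (suc k ∈ rises π) ⇔ (suc k < n × c k ≡ + 1 ℤ.+ c (suc k))
  rise⇔ k = mk⇔ to from
    where
    to : suc k ∈ rises π → suc k < n × c k ≡ + 1 ℤ.+ c (suc k)
    to mem with rises⇒ 0 0 π mem
    ... | _ , refl , k< , eq = k<n , rise⇒drop k k<n eq
      where k<n = subst (suc k <_) (proj₁ inL) k<
    from : suc k < n × c k ≡ + 1 ℤ.+ c (suc k) → suc k ∈ rises π
    from (k< , eq) = rises⇐ 0 0 π k (subst (suc k <_) (sym (proj₁ inL)) k<) (drop⇒rise k k< eq)

  starts⇔ : StartsWithN π ⇔ (c 0 ≡ - + 1)
  starts⇔ = mk⇔
    (λ s → trans c-first (cong (λ z → + z ℤ.- + 1) (starts⇒ s)))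
    (λ eq → starts⇐ π (subst (0 <_) (sym (proj₁ inL)) (s≤s z≤n))
      (ℤP.+-injective (≡-by {a = c 0} {b = - + 1} eq (trans (ring (+ p 0)) (cong (λ z → - + 1 ℤ.- z) (sym c-first))))))
    where
    ring : ∀ a → + 0 ℤ.- a ≡ - + 1 ℤ.- (a ℤ.- + 1)
    ring = solve-∀

-- Entries of a signed permutation.

nth-∈ : ∀ v k → k < length v → nth v k ∈ v
nth-∈ (y ∷ v) zero _ = here refl
nth-∈ (y ∷ v) (suc k) (s≤s k<) = there (nth-∈ v k k<)

∈⇒nth : ∀ {y v} → y ∈ v → ∃[ k ] k < length v × y ≡ nth v k
∈⇒nth (here refl) = 0 , s≤s z≤n , refl
∈⇒nth (there y∈) with ∈⇒nth y∈
... | k , k< , eq = suc k , s≤s k< , eq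

unique-abs⇒nth-injective : ∀ v k l → Unique (map ∣_∣ v) → k < length v → l < length v →
  ∣ nth v k ∣ ≡ ∣ nth v l ∣ → k ≡ l
unique-abs⇒nth-injective (y ∷ v) zero zero _ _ _ _ = refl
unique-abs⇒nth-injective (y ∷ v) zero (suc l) (ne ∷ _) _ (s≤s l<) eq =
  ⊥-elim (All.lookup ne (∈-map⁺ ∣_∣ (nth-∈ v l l<)) eq)
unique-abs⇒nth-injective (y ∷ v) (suc k) zero (ne ∷ _) (s≤s k<) _ eq =
  ⊥-elim (All.lookup ne (∈-map⁺ ∣_∣ (nth-∈ v k k<)) (sym eq))
unique-abs⇒nth-injective (y ∷ v) (suc k) (suc l) (_ ∷ un) (s≤s k<) (s≤s l<) eq =
  cong suc (unique-abs⇒nth-injective v k l un k< l< eq)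

signed-last : ∀ b n y → signed b n (n , y) ≡ (if b then - y else y)
signed-last b n y rewrite ≡ᵇ-refl n = refl

neg-fixed⇒0 : ∀ {z} → z ≡ - z → z ≡ + 0
neg-fixed⇒0 {+ zero} _ = refl

∣∣≤ : ∀ {z b} → - + b ℤ.≤ z → z ℤ.≤ + b → ∣ z ∣ ≤ b
∣∣≤ {+ a} _ hi = ℤP.drop‿+≤+ hi
∣∣≤ { -[1+ a ]} {b} lo _ = ℤP.drop‿+≤+ (subst (ℤ._≤_ _) (ℤP.neg-involutive (+ b)) (ℤP.neg-mono-≤ lo))

-- The core argument applied to a labelled path.

module _ (m : ℕ) (π : List Step) (v : List ℤ) (inVert : InVert (suc (suc m)) π v) where

  private
    n : ℕ
    n = suc (suc m)

    inL : InL n π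
    inL = proj₁ inVert

    length-v : length v ≡ n
    length-v = proj₁ (proj₁ (proj₂ inVert))

    u : ℕ → ℤ
    u = nth v

    -- Chosen so that `suc M` computes to 2n, the index of the first scan in ζ_B.
    M : ℕ
    M = suc m ℕ.+ (n ℕ.+ 0)

    n≤2n : n ≤ suc M
    n≤2n = ℕP.m≤m+n n (n ℕ.+ 0)

    n<2n : n < suc M
    n<2n = ℕP.m<m+n n (s≤s z≤n)

  open Heights m π inL

  private
    lower : ∀ k → k < n → - + suc M ℤ.≤ c k
    lower k k< = ℤP.≤-trans (ℤP.neg-mono-≤ (ℤ.+≤+ n≤2n)) (-n≤c k k<)

    upper : ∀ k → k < n → c k ℤ.≤ + suc M
    upper k k< = ℤP.≤-trans (c≤n k k<) (ℤ.+≤+ n≤2n)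

  open Core m u c c-step -1≤c last-bound M lower upper

  private
    X : List Row
    X = applyUpTo row (suc m)

    rows-split : rows ≡ X ++ (u (suc m) , x) ∷ []
    rows-split = trans (sym (applyUpTo-∷ʳ row (suc m))) (cong (λ h → X ++ (u (suc m) , h) ∷ []) c-last)

    muRow-inner : ∀ k → k < suc m → muRow n π v k ≡ row k
    muRow-inner k k< = cong₂ _,_ label (muAt-inner k<)
      where
      label : signed (flipped n π) n (suc k , at v (suc k)) ≡ u k
      label rewrite <⇒≡ᵇ-false k< = refl

    muRows-split : applyUpTo (muRow n π v) n ≡ X ++ muRow n π v (suc m) ∷ []
    muRows-split = trans (sym (applyUpTo-∷ʳ (muRow n π v) (suc m)))
      (cong (_++ muRow n π v (suc m) ∷ []) (applyUpTo-cong (suc m) muRow-inner))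

    muRow-last : muRow n π v (suc m) ≡ (u (suc m) , x) ⊎ muRow n π v (suc m) ≡ (- u (suc m) , reflect x)
    muRow-last with muAt-last
    ... | inj₁ eq = inj₁ (cong₂ _,_ label eq)
      where
      label : signed (flipped n π) n (n , at v n) ≡ u (suc m)
      label = trans (signed-last (flipped n π) n (u (suc m))) (cong (if_then - u (suc m) else u (suc m)) (flipped-x eq))
    ... | inj₂ eq = inj₂ (cong₂ _,_ label eq)
      where
      label : signed (flipped n π) n (n , at v n) ≡ - u (suc m)
      label = trans (signed-last (flipped n π) n (u (suc m))) (cong (if_then - u (suc m) else u (suc m)) (flipped-reflect eq))

    window≡ : ∀ B → window (applyUpTo (muRow n π v) n) B ≡ window rows B
    window≡ B = trans (cong (λ R → window R B) muRows-split) (trans (last-row muRow-last) (cong (λ R → window R B) (sym rows-split)))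
      where
      last-row : ∀ {r} → r ≡ (u (suc m) , x) ⊎ r ≡ (- u (suc m) , reflect x) →
        window (X ++ r ∷ []) B ≡ window (X ++ (u (suc m) , x) ∷ []) B
      last-row (inj₁ refl) = refl
      last-row (inj₂ refl) = window-reflect X (u (suc m)) x B

    -- The bound of d_B is computed from μ_n; it also covers x, because reflection preserves the
    -- index.
    indexed-rows : IndexedBy rows (dBound n π)
    indexed-rows = subst (λ R → IndexedBy R (dBound n π)) (sym rows-split)
      (AllP.++⁺ (AllP.++⁻ˡ X indexed) (last-row muRow-last (All.head (AllP.++⁻ʳ X indexed)) ∷ []))
      where
      indexed : IndexedBy (X ++ muRow n π v (suc m) ∷ []) (dBound n π)
      indexed = subst (λ R → IndexedBy R (dBound n π)) muRows-split (indexed-dBound n π v)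
      last-row : ∀ {r b} → r ≡ (u (suc m) , x) ⊎ r ≡ (- u (suc m) , reflect x) →
        index (proj₂ r) ≤ b → index x ≤ b
      last-row (inj₁ refl) le = le
      last-row (inj₂ refl) le = subst (_≤ _) (index-reflect x) le

    indexed-rows′ : IndexedBy rows (suc M)
    indexed-rows′ = AllP.applyUpTo⁺₁ row n λ {k} k< →
      ℕP.≤-trans (index-≤ (c k)) (ℕP.≤-trans (∣∣≤ (-n≤c k k<) (c≤n k k<)) n≤2n)

    w : List ℤ
    w = dB n π v

    w≡ : w ≡ window rows (dBound n π)
    w≡ = trans (dB-window n π v) (window≡ (dBound n π))

    length-w : length w ≡ n
    length-w = trans (cong length w≡) (trans (length-window rows indexed-rows) (length-applyUpTo row n))

    reverse-w : reverse w ≡ levels (suc M)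
    reverse-w = trans (cong reverse (trans w≡ (window-unique rows indexed-rows indexed-rows′))) (reverse-window rows (suc M))

  open Window w length-w reverse-w

  private
    zeta≡ : zetaB n π ≡ β
    zeta≡ = begin
      zetaWord (2 ℕ.* n) (mu n π)                            ≡⟨ cong (zetaWord (2 ℕ.* n)) mu≡ ⟩
      zetaWord (2 ℕ.* n) (applyUpTo c (suc m) ++ muAt n π n ∷ []) ≡⟨ last-height muAt-last ⟩
      zetaWord (2 ℕ.* n) (applyUpTo c (suc m) ++ x ∷ [])     ≡⟨ cong (zetaWord (2 ℕ.* n)) heights≡ ⟨
      zetaWord (2 ℕ.* n) (map proj₂ rows)                    ≡⟨ zetaWord≡word rows (2 ℕ.* n) ⟩
      β                                                      ∎
      where
      open ≡-Reasoning
      muAt′ : ℕ → ℤ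
      muAt′ k = muAt n π (suc k)
      mu≡ : mu n π ≡ applyUpTo c (suc m) ++ muAt n π n ∷ []
      mu≡ = trans (map-upTo muAt′ n) (trans (sym (applyUpTo-∷ʳ muAt′ (suc m)))
        (cong (_++ muAt n π n ∷ []) (applyUpTo-cong (suc m) (λ k → muAt-inner))))
      heights≡ : map proj₂ rows ≡ applyUpTo c (suc m) ++ x ∷ []
      heights≡ = trans (map-applyUpTo row proj₂ n) (trans (sym (applyUpTo-∷ʳ c (suc m)))
        (cong (λ h → applyUpTo c (suc m) ++ h ∷ []) c-last))
      last-height : ∀ {h} → h ≡ x ⊎ h ≡ reflect x →
        zetaWord (2 ℕ.* n) (applyUpTo c (suc m) ++ h ∷ []) ≡ zetaWord (2 ℕ.* n) (applyUpTo c (suc m) ++ x ∷ [])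
      last-height (inj₁ refl) = refl
      last-height (inj₂ refl) = zetaWord-reflect (2 ℕ.* n) (applyUpTo c (suc m)) x
        (subst (- + (2 ℕ.* n) ℤ.<_) c-last
          (ℤP.<-≤-trans (ℤP.neg-mono-< (ℤ.+<+ n<2n)) (-n≤c (suc m) ℕP.≤-refl)))
        (subst (ℤ._≤ + (2 ℕ.* n)) c-last (upper (suc m) ℕP.≤-refl))

    k<length : ∀ {k} → k < n → k < length v
    k<length = subst (_ <_) (sym length-v)

    u-injective : ∀ {k l} → k < n → l < n → ∣ u k ∣ ≡ ∣ u l ∣ → k ≡ l
    u-injective k< l< = unique-abs⇒nth-injective v _ _ (proj₂ (proj₂ (proj₁ (proj₂ inVert)))) (k<length k<) (k<length l<)

    u≢0 : ∀ {k} → k < n → u k ≢ + 0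
    u≢0 {k} k< = proj₁ (All.lookup (proj₁ (proj₂ (proj₁ (proj₂ inVert)))) (nth-∈ v k (k<length k<)))

    -- Entries are nonzero with distinct absolute values, so none is the negative of an entry.
    u≢-u : ∀ {y} → IsU y → ¬ IsNegU y
    u≢-u (k , k< , refl) (l , l< , eq)
      with refl ← u-injective k< l< (trans (cong ∣_∣ eq) (ℤP.∣-i∣≡∣i∣ (u l))) = u≢0 k< (neg-fixed⇒0 eq)

    isU : ∀ {y} → y ∈ v → IsU y
    isU y∈ with ∈⇒nth y∈
    ... | k , k< , eq = k , subst (k <_) length-v k< , eq

    neg-isU : ∀ {y} → IsU y → IsNegU (- y)
    neg-isU (k , k< , eq) = k , k< , cong -_ eq

    isU⇒≢0 : ∀ {y} → IsU y → y ≢ + 0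
    isU⇒≢0 (k , k< , refl) = u≢0 k<

    RiseAt⇒label : ∀ {k a b} → RiseAt k → u k ≡ a → u (suc k) ≡ b → HasRiseLabel π v a b
    RiseAt⇒label {k} rise eq eq′ = suc k , Equivalence.from (rise⇔ k) rise , eq , eq′

    -- Signs leave one case: the label b of the E is not negated, which excludes S⁺ and the valley
    -- created by the deletion, and a ≠ 0 excludes the central N.
    valley⇒rise : ∀ {a b} → IsU a → IsU b → HasValleyLabel n β w b a → HasRiseLabel π v a b
    valley⇒rise ua ub val with label⇒ val
    ... | inj₁ (inj₁ (k , rise , inj₁ (eq , eq′)) , _) = RiseAt⇒label rise (sym eq′) (sym eq)
    ... | inj₁ (inj₁ (k , rise , inj₂ (eq , _)) , _) = ⊥-elim (u≢-u ub (k , ℕP.<⇒≤ (proj₁ rise) , eq))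
    ... | inj₁ (inj₂ eq , _) = ⊥-elim (isU⇒≢0 ua eq)
    ... | inj₂ (neg , _) = ⊥-elim (u≢-u ub neg)

    -- Now -a excludes S⁻, and -b excludes both the central N and the valley created by the
    -- deletion.
    valley⁻⇒rise : ∀ {a b} → IsU a → IsU b → HasValleyLabel n β w (- a) (- b) → HasRiseLabel π v a b
    valley⁻⇒rise ua ub val with label⇒ val
    ... | inj₁ (inj₁ (k , rise , inj₁ (eq , _)) , _) = ⊥-elim (u≢-u (suc k , proj₁ rise , eq) (neg-isU ua))
    ... | inj₁ (inj₁ (k , rise , inj₂ (eq , eq′)) , _) =
      RiseAt⇒label rise (sym (ℤP.neg-injective eq)) (sym (ℤP.neg-injective eq′))
    ... | inj₁ (inj₂ eq , _) = ⊥-elim (isU⇒≢0 ub (ℤP.neg-injective eq))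
    ... | inj₂ (_ , u) = ⊥-elim (u≢-u u (neg-isU ub))

    rise⇒valley : ∀ {a b} → HasRiseLabel π v a b →
      HasValleyLabel n β w b a ⊎ HasValleyLabel n β w (- a) (- b)
    rise⇒valley (i , mem , eq , eq′) with rises⇒ 0 0 π mem
    rise⇒valley (_ , mem , refl , refl) | k , refl , _ = rise⇒label k (Equivalence.to (rise⇔ k) mem)

    -- By `Origin`, an E labelled v(1) comes from row 1 with c_1 < 0, and c_1 ≥ -1.
    valley₀⇒first : HasValleyLabel n β w (u 0) (+ 0) → c 0 ≡ - + 1
    valley₀⇒first val with label⇒ val
    ... | inj₁ (_ , inj₁ neg) = ⊥-elim (u≢-u (0 , s≤s z≤n , refl) neg)
    ... | inj₂ (neg , _) = ⊥-elim (u≢-u (0 , s≤s z≤n , refl) neg)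
    ... | inj₁ (_ , inj₂ (k , k< , eq , c<0)) with refl ← u-injective (s≤s z≤n) k< (cong ∣_∣ eq) =
      ℤP.≤-antisym (ℤP.i<j⇒i≤pred[j] c<0) -1≤c

  rises⇔valleys : (∀ a b → a ∈ v → b ∈ v →
      (HasRiseLabel π v a b ⇔
        (HasValleyLabel n (zetaB n π) (dB n π v) b a
          ⊎ HasValleyLabel n (zetaB n π) (dB n π v) (- a) (- b))))
    × (StartsWithN π ⇔ HasValleyLabel n (zetaB n π) (dB n π v) (at v 1) (+ 0))
  rises⇔valleys rewrite zeta≡ =
    (λ a b a∈ b∈ → mk⇔ rise⇒valley Sum.[ valley⇒rise (isU a∈) (isU b∈) , valley⁻⇒rise (isU a∈) (isU b∈) ]) ,
    mk⇔ (first⇒label ∘ Equivalence.to starts⇔) (Equivalence.from starts⇔ ∘ valley₀⇒first)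

theorem6p19 : (n : ℕ) → 2 ≤ n → (π : List Step) (v : List ℤ) → InVert n π v →
    (∀ a b → a ∈ v → b ∈ v →
    (HasRiseLabel π v a b ⇔
    (HasValleyLabel n (zetaB n π) (dB n π v) b a
    ⊎ HasValleyLabel n (zetaB n π) (dB n π v) (- a) (- b))))
    × (StartsWithN π ⇔ HasValleyLabel n (zetaB n π) (dB n π v) (at v 1) (+ 0))
theorem6p19 (suc zero) (s≤s ())
theorem6p19 (suc (suc m)) _ π v inVert = rises⇔valleys m π v inVert
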